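{- Let $G$ be an extremal $4$-cactus with $n\ge 1$ vertices. Then: (1) If $n\equiv 0\pmod 3$, then $G$ is obtained by coalescing $\frac{n-3}{3}$ copies of $K_4$ and one copy of $K_3$, or obtained by coalescing $\frac{n-6}{3}$ copies of $K_4$ and one copy of $\theta(1,2,2,2,2)$. (2) If $n\equiv 1\pmod 3$ and $n\ne 1$, then $G$ is obtained by coalescing $\frac{n-1}{3}$ copies of $K_4$; if $n=1$, then $G\cong K_1$. (3) If $n\equiv 2\pmod 3$, then $G$ is either obtained by coalescing $\frac{n-2}{3}$ copies of $K_4$ and one copy of $K_2$, or obtained by coalescing $\frac{n-5}{3}$ copies of $K_4$ and exactly one copy of one of the graphs $\theta(1,2,2,2)$, $\tilde{\theta}_1$, $\tilde{\theta}_2$.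
   Context: All graphs are finite and simple. For an integer $k\ge 1$, a $k$-cactus is a connected graph in which every edge is contained in at most $k$ cycles. A $k$-cactus with $n$ vertices is extremal if it has the largest number of edges among all $k$-cacti with $n$ vertices. For $t\ge 3$, $\theta(l_1,\dots,l_t)$ denotes the union of $t$ internally vertex-disjoint paths of lengths $l_1,\dots,l_t$ with the same two end-vertices. The graphs $\tilde{\theta}_1$ and $\tilde{\theta}_2$ are the two graphs on 5 vertices with 7 edges other than $\theta(1,2,2,2)$ that are $2$-connected: namely the complement of the disjoint union of a path with 3 edges and an isolated vertex, and the complement of the disjoint union of a path with 2 edges and a single edge. The coalescence of two vertex-disjoint graphs $G_1,G_2$ at vertices $v_1\in V(G_1)$, $v_2\in V(G_2)$ is the graph obtained from $G_1\cup G_2$ by identifying $v_1$ and $v_2$ into one vertex; a coalescence of several pairwise disjoint graphs is defined iteratively. "Obtained by coalescing" the listed graphs means $G$ is some such coalescence of them. -}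

module Defs where

open import Data.Bool using (Bool; true; false; not; _∧_; _∨_; if_then_else_)
open import Data.Bool.Properties using (∨-comm)
open import Data.Nat using (ℕ; zero; suc; _+_; _*_; _∸_; _≤_; _<ᵇ_; _%_; _/_)
open import Data.Fin using (Fin; toℕ; _≟_)
open import Data.Fin.Properties using ()
open import Data.List using (List; []; _∷_; _++_; [_]; length; take; map; allFin; replicate)
open import Data.Nat.ListAction using (sum)
open import Data.List.Relation.Unary.All using (All)
open import Data.List.Relation.Unary.AllPairs using (AllPairs)
open import Data.List.Relation.Unary.Unique.Propositional using (Unique)
open import Data.List.Relation.Binary.Permutation.Propositional using (_↭_)
open import Data.Product using (Σ; ∃; _×_; _,_)
open import Data.Sum using (_⊎_)
open import Data.Empty using (⊥)
open import Data.Unit using (⊤)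
open import Relation.Nullary using (¬_; yes; no)
open import Relation.Nullary.Decidable using (⌊_⌋)
open import Relation.Binary.PropositionalEquality using (_≡_; refl; sym; cong)

record Graph (n : ℕ) : Set where
  field
    adj    : Fin n → Fin n → Bool
    adj-sym : ∀ i j → adj i j ≡ adj j i
    adj-irr : ∀ i → adj i i ≡ false
open Graph public

AnyGraph : Set
AnyGraph = Σ ℕ Graph

edgeCount : ∀ {n} → Graph n → ℕ
edgeCount {n} G =
  sum (map (λ i → sum (map (λ j → if adj G i j ∧ (toℕ i <ᵇ toℕ j) then 1 else 0)
                           (allFin n)))
           (allFin n))

data Reach {n} (G : Graph n) : Fin n → Fin n → Set where
  here : ∀ {u} → Reach G u u
  step : ∀ {u w v} → adj G u w ≡ true → Reach G w v → Reach G u v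

Connected : ∀ {n} → Graph n → Set
Connected {n} G = ∀ (u v : Fin n) → Reach G u v

-- Cycles.  A cycle is given by a list of distinct vertices v0,...,v(m-1),
-- m ≥ 3, with consecutive vertices (cyclically) adjacent.  As a subgraph,
-- a cycle is identified with its edge set; two vertex lists describe the
-- same cycle iff they have the same edge set.

Linked : ∀ {n} → Graph n → List (Fin n) → Set
Linked G []           = ⊤
Linked G (x ∷ [])     = ⊤
Linked G (x ∷ y ∷ zs) = (adj G x y ≡ true) × Linked G (y ∷ zs)

close : ∀ {n} → List (Fin n) → List (Fin n)
close vs = vs ++ take 1 vs

IsCycle : ∀ {n} → Graph n → List (Fin n) → Set
IsCycle G vs = (3 ≤ length vs) × Unique vs × Linked G (close vs)

ConsecIn : ∀ {n} → List (Fin n) → Fin n → Fin n → Set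
ConsecIn []           a b = ⊥
ConsecIn (x ∷ [])     a b = ⊥
ConsecIn (x ∷ y ∷ zs) a b =
  ((a ≡ x) × (b ≡ y)) ⊎ ((a ≡ y) × (b ≡ x)) ⊎ ConsecIn (y ∷ zs) a b

CycEdge : ∀ {n} → List (Fin n) → Fin n → Fin n → Set
CycEdge vs a b = ConsecIn (close vs) a b

SameCycle : ∀ {n} → List (Fin n) → List (Fin n) → Set
SameCycle {n} vs ws =
  ∀ (a b : Fin n) → (CycEdge vs a b → CycEdge ws a b) × (CycEdge ws a b → CycEdge vs a b)

EdgeInAtMostCycles : ∀ {n} → ℕ → Graph n → Set
EdgeInAtMostCycles {n} k G =
  ∀ (a b : Fin n) → adj G a b ≡ true →
  ∀ (cs : List (List (Fin n))) →
    All (IsCycle G) cs →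
    All (λ c → CycEdge c a b) cs →
    AllPairs (λ c d → ¬ SameCycle c d) cs →
    length cs ≤ k

IsCactus : ∀ {n} → ℕ → Graph n → Set
IsCactus k G = Connected G × EdgeInAtMostCycles k G

Extremal : ∀ {n} → ℕ → Graph n → Set
Extremal {n} k G = IsCactus k G × (∀ (H : Graph n) → IsCactus k H → edgeCount H ≤ edgeCount G)

record Iso {n m} (G : Graph n) (H : Graph m) : Set where
  field
    to      : Fin n → Fin m
    from    : Fin m → Fin n
    from-to : ∀ i → from (to i) ≡ i
    to-from : ∀ j → to (from j) ≡ j
    adj-pres : ∀ i j → adj H (to i) (to j) ≡ adj G i j

-- Coalescence.  K is (a copy of) the coalescence of G at v and H at w:
-- V(K) is the union of an injective copy f of V(G) and an injective copy g
-- of V(H) that meet exactly in f v = g w; the edges of K are exactly the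
-- copies of the edges of G and of H.

record CoalAt {a b N} (G : Graph a) (v : Fin a) (H : Graph b) (w : Fin b) (K : Graph N) : Set where
  field
    f : Fin a → Fin N
    g : Fin b → Fin N
    f-inj : ∀ i i' → f i ≡ f i' → i ≡ i'
    g-inj : ∀ j j' → g j ≡ g j' → j ≡ j'
    glue  : f v ≡ g w
    meet  : ∀ i j → f i ≡ g j → (i ≡ v) × (j ≡ w)
    cover : ∀ x → (∃ λ i → f i ≡ x) ⊎ (∃ λ j → g j ≡ x)
    adj-f : ∀ i i' → adj K (f i) (f i') ≡ adj G i i'
    adj-g : ∀ j j' → adj K (g j) (g j') ≡ adj H j j'
    adj-fg : ∀ i j → adj K (f i) (g j) ≡ true → (i ≡ v) ⊎ (j ≡ w)

data CoalOf : List AnyGraph → ∀ {N} → Graph N → Set where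
  one  : ∀ {m N} {H : Graph m} {K : Graph N} → Iso H K → CoalOf ((m , H) ∷ []) K
  step : ∀ {Hs a b N} {G : Graph a} {H : Graph b} {K : Graph N} (v : Fin a) (w : Fin b) →
         CoalOf Hs G → CoalAt G v H w K → CoalOf ((b , H) ∷ Hs) K

Obtained : List AnyGraph → ∀ {N} → Graph N → Set
Obtained Hs K = ∃ λ Ks → (Ks ↭ Hs) × CoalOf Ks K

mkGraph : ∀ {n} → (Fin n → Fin n → Bool) → Graph n
mkGraph {n} r = record { adj = A ; adj-sym = S ; adj-irr = I }
  where
  A : Fin n → Fin n → Bool
  A i j = not ⌊ i ≟ j ⌋ ∧ (r i j ∨ r j i)
  S : ∀ i j → A i j ≡ A j i
  S i j with i ≟ j | j ≟ i
  ... | yes _ | yes _ = refl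
  ... | no _  | no _  = ∨-comm (r i j) (r j i)
  ... | yes p | no q  with q (sym p)
  ...   | ()
  S i j | no q | yes p with q (sym p)
  ...   | ()
  I : ∀ i → A i i ≡ false
  I i with i ≟ i
  ... | yes _ = refl
  ... | no q with q refl
  ...   | ()

mkGraphℕ : ∀ {n} → (ℕ → ℕ → Bool) → Graph n
mkGraphℕ r = mkGraph (λ i j → r (toℕ i) (toℕ j))

K : (m : ℕ) → AnyGraph
K m = m , mkGraph (λ _ _ → true)

-- θ(1,2,...,2) with t paths of length 2: end-vertices 0 and 1 joined by an
-- edge, and every further vertex 2,...,t+1 adjacent to both 0 and 1
θ12 : (t : ℕ) → AnyGraph
θ12 t = (2 + t) , mkGraphℕ r
  where
  r : ℕ → ℕ → Bool
  r 0 _ = true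
  r 1 _ = true
  r _ _ = false

-- θ̃₁ : complement of P4 ∪ K1 (P4 = 0-1-2-3, isolated vertex 4)
θ̃₁ : AnyGraph
θ̃₁ = 5 , mkGraphℕ r
  where
  p : ℕ → ℕ → Bool
  p 0 1 = true
  p 1 2 = true
  p 2 3 = true
  p _ _ = false
  r : ℕ → ℕ → Bool
  r i j = not (p i j ∨ p j i)

-- θ̃₂ : complement of P3 ∪ K2 (P3 = 0-1-2, K2 = 3-4)
θ̃₂ : AnyGraph
θ̃₂ = 5 , mkGraphℕ r
  where
  p : ℕ → ℕ → Bool
  p 0 1 = true
  p 1 2 = true
  p 3 4 = true
  p _ _ = false
  r : ℕ → ℕ → Bool
  r i j = not (p i j ∨ p j i)

copies : ℕ → AnyGraph → List AnyGraph
copies = replicate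

{-# OPTIONS --safe #-}
module Submission where

-- Put f = 2 (n - 1) - e. It is additive over blocks, and the windmill of copies of K₄ (with a
-- smaller last blade) shows that an extremal 4-cactus has f = 0 if n ≡ 1 (mod 3) and f ≤ 1 otherwise.
-- In a 2-connected graph each ear of an ear decomposition yields one more cycle through a fixed
-- edge: in an st-order of the part built so far, descend from the lower end of the ear to a, ascend
-- from the upper end to b, and close up with the edge ab. So a block has cyclomatic number at most 4,
-- whence f ≥ 2 for n ≥ 7, and the graphs on at most six vertices are settled by computation: f = 0
-- only for K₄, and f = 1 only for K₂, K₃, K₄ - e, θ(1,2,2,2), θ̃₁, θ̃₂ and θ(1,2,2,2,2).

open import Defs
import Algebra.Properties.Semiring.Sum as Sum
open import Data.Bool using (Bool; true; false; _∧_; _∨_; if_then_else_)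
open import Data.Bool.Properties using (∧-zeroʳ; ∧-identityʳ) renaming (_≟_ to _≟ᵇ_)
open import Data.Empty using (⊥; ⊥-elim)
open import Data.Fin using (Fin; zero; suc; toℕ; fromℕ<; _≟_)
import Data.Fin.Properties as Fin
open import Data.Fin.Properties using (toℕ-injective; any?; toℕ<n; toℕ-fromℕ<)
open import Data.List using (List; []; _∷_; _++_; [_]; length; map; allFin; tabulate; filter; lookup; take; reverse; concatMap)
open import Data.List.Membership.DecPropositional using (_∈?_)
open import Data.List.Membership.Propositional using (_∈_; _∉_; find)
open import Data.List.Membership.Propositional.Properties using (∈-++⁻; ∈-++⁺ˡ; ∈-++⁺ʳ; ∈-filter⁺; ∈-filter⁻; ∈-lookup; ∈-allFin; ∈-∃++)
open import Data.List.Properties using (map-tabulate; map-++; length-map; length-++; unfold-reverse; reverse-++; reverse-involutive; ++-assoc; length-tabulate)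
import Data.List.Relation.Unary.All as All
open import Data.List.Relation.Unary.All using (All; []; _∷_)
import Data.List.Relation.Unary.All.Properties as AllP
import Data.List.Relation.Unary.AllPairs as AllPairs
open import Data.List.Relation.Unary.AllPairs using (AllPairs; []; _∷_)
import Data.List.Relation.Unary.Any as Any
open import Data.List.Relation.Unary.Any using (Any; here; there; index)
import Data.List.Relation.Unary.Any.Properties as AnyP
open import Data.List.Relation.Unary.Any.Properties using (lookup-index)
open import Data.List.Relation.Unary.Unique.Propositional using (Unique)
import Data.List.Relation.Unary.Unique.Propositional.Properties as Unique
open import Data.List.Relation.Binary.Permutation.Propositional using (_↭_; ↭-refl; prep)
open import Data.List.Relation.Binary.Permutation.Propositional.Properties using (∷↭∷ʳ)
open import Data.Nat using (ℕ; zero; suc; _+_; _*_; _∸_; _≤_; _<_; _<ᵇ_; _≤?_; _/_; _%_; z≤n; s≤s)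
open import Data.Nat.DivMod
import Data.Nat as Nat
open import Data.Nat.Divisibility using (n∣m*n)
open import Data.Nat.ListAction using () renaming (sum to sumL)
open import Data.Nat.Properties hiding (_≟_)
open import Data.Nat.Tactic.RingSolver using (solve-∀)
open import Algebra.Properties.CommutativeSemigroup +-commutativeSemigroup using (interchange; x∙yz≈y∙xz)
open import Data.Product using (Σ; ∃; _×_; _,_; proj₁; proj₂)
open import Data.Sum using (_⊎_; inj₁; inj₂; swap; map₂)
open import Data.Unit using (⊤; tt)
open import Data.Vec using (Vec; []; _∷_) renaming (lookup to lookupᵛ; tabulate to tabulateᵛ)
open import Data.Vec.Properties using (lookup∘tabulate)
open import Data.List.Relation.Unary.Unique.DecPropositional using (unique?)
open import Function using (_∘_)
open import Level using (0ℓ)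
open import Relation.Binary using (Rel)
open import Relation.Binary.Definitions using (tri<; tri≈; tri>)
open import Relation.Binary.PropositionalEquality using (_≡_; _≢_; refl; sym; trans; cong; cong₂; subst; module ≡-Reasoning)
open import Relation.Nullary using (¬_; yes; no; Dec; does)
open import Relation.Nullary.Decidable using (⌊_⌋; _×-dec_; _⊎-dec_; ¬?; False; toWitnessFalse; _→-dec_; map′)
open import Relation.Unary using (Pred; Decidable)

open Sum +-*-semiring using (sum-cong-≗; ∑-comm; ∑-distrib-+; *-distribˡ-sum; *-distribʳ-sum; sum-syntax; sum)

-- Counting edges

-- Additivity holds because a coalescence has `n = a + b - 1` and adds the edge counts. Every block
-- has `f ≥ 0`, so a graph with `f ≤ 1` has at most one block other than K₄. The block K₄ - e also
-- has `f = 1`, but its order 4 keeps `n ≡ 1 (mod 3)`, where the windmill forces `f = 0`; hence its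
-- absence from the theorem. No block tree is built. A coalescence list grows by one graph at a
-- time, so the induction splits off a leaf block, which is classified directly. Six vertices bound
-- the computation since `e ≤ n + 3` means `f ≥ n - 5`. All counted cycles must share one fixed
-- edge, and a bare ear decomposition does not tell how to close a new cycle through it without
-- crossing itself; the st-order, updated with every ear, does. The lower bound needs the windmill
-- to be a 4-cactus. Each of its cycles stays in one blade together with the hub, and this part
-- embeds in K₄, where the cycles through an edge are enumerated.

true≢false : ∀ {b} → b ≡ true → b ≡ false → ⊥
true≢false refl ()

⟦_⟧ : Bool → ℕ
⟦ b ⟧ = if b then 1 else 0

<ᵇ-true : ∀ {m n} → m < n → (m <ᵇ n) ≡ true
<ᵇ-true {zero}  (s≤s _) = refl
<ᵇ-true {suc m} (s≤s p@(s≤s _)) = <ᵇ-true p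

<ᵇ-false : ∀ {m n} → n ≤ m → (m <ᵇ n) ≡ false
<ᵇ-false z≤n = refl
<ᵇ-false (s≤s p) = <ᵇ-false p

sum-tabulate : ∀ {n} (h : Fin n → ℕ) → sumL (tabulate h) ≡ sum h
sum-tabulate {zero}  h = refl
sum-tabulate {suc n} h = cong (h zero +_) (sum-tabulate (h ∘ suc))

sum-allFin : ∀ {n} (h : Fin n → ℕ) → sumL (map h (allFin n)) ≡ sum h
sum-allFin h = trans (cong sumL (map-tabulate (λ i → i) h)) (sum-tabulate h)

sum-mono : ∀ {n} {g h : Fin n → ℕ} → (∀ i → g i ≤ h i) → sum g ≤ sum h
sum-mono {zero}  p = z≤n
sum-mono {suc n} p = +-mono-≤ (p zero) (sum-mono (p ∘ suc))

sum-zero : ∀ {n} {h : Fin n → ℕ} → (∀ i → h i ≡ 0) → sum h ≡ 0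
sum-zero {zero}  p = refl
sum-zero {suc n} p = cong₂ _+_ (p zero) (sum-zero (p ∘ suc))

sum-one : ∀ n → ∑[ i < n ] 1 ≡ n
sum-one zero    = refl
sum-one (suc n) = cong suc (sum-one n)

δ : ∀ {n} → Fin n → Fin n → ℕ
δ i x = ⟦ ⌊ i ≟ x ⌋ ⟧

δ-refl : ∀ {n} (i : Fin n) → δ i i ≡ 1
δ-refl i with i ≟ i
... | yes _ = refl
... | no q  = ⊥-elim (q refl)

δ-≢ : ∀ {n} {i j : Fin n} → i ≢ j → δ i j ≡ 0
δ-≢ {i = i} {j} q with i ≟ j
... | yes p = ⊥-elim (q p)
... | no _  = refl

δ-suc : ∀ {n} (i j : Fin n) → δ (Fin.suc i) (suc j) ≡ δ i j
δ-suc i j with i ≟ j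
... | yes _ = refl
... | no _  = refl

sum-δ : ∀ {n} (i : Fin n) (h : Fin n → ℕ) → ∑[ x < n ] (δ i x * h x) ≡ h i
sum-δ {suc n} zero    h =
  trans (cong₂ _+_ (*-identityˡ (h zero)) (sum-zero {n} (λ _ → refl))) (+-identityʳ _)
sum-δ {suc n} (suc i) h =
  trans (sum-cong-≗ (λ x → cong (_* h (suc x)) (δ-suc i x))) (sum-δ i (h ∘ suc))

edgeCount-sum : ∀ {n} (G : Graph n) →
  edgeCount G ≡ ∑[ i < n ] ∑[ j < n ] ⟦ adj G i j ∧ (toℕ i <ᵇ toℕ j) ⟧
edgeCount-sum {n} G = trans (sum-allFin (λ i → sumL (map (up i) (allFin n))))
                            (sum-cong-≗ (λ i → sum-allFin (up i)))
  where
  up : Fin n → Fin n → ℕ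
  up i j = ⟦ adj G i j ∧ (toℕ i <ᵇ toℕ j) ⟧

degreeSum : ∀ {n} → Graph n → ℕ
degreeSum {n} G = ∑[ i < n ] ∑[ j < n ] ⟦ adj G i j ⟧

split-adj : ∀ {n} (G : Graph n) i j →
  ⟦ adj G i j ⟧ ≡ ⟦ adj G i j ∧ (toℕ i <ᵇ toℕ j) ⟧ + ⟦ adj G j i ∧ (toℕ j <ᵇ toℕ i) ⟧
split-adj G i j rewrite adj-sym G j i with <-cmp (toℕ i) (toℕ j)
... | tri< p _ _ rewrite <ᵇ-true p | <ᵇ-false (<⇒≤ p)
    | ∧-identityʳ (adj G i j) | ∧-zeroʳ (adj G i j) = sym (+-identityʳ _)
... | tri> _ _ p rewrite <ᵇ-true p | <ᵇ-false (<⇒≤ p)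
    | ∧-identityʳ (adj G i j) | ∧-zeroʳ (adj G i j) = refl
... | tri≈ _ p _ rewrite toℕ-injective p | adj-irr G j = refl

-- `edgeCount` looks at the numbering of the vertices, which the embeddings of a coalescence need
-- not respect. The degree sum does not, so additivity is proved for it and then halved.
handshake : ∀ {n} (G : Graph n) → degreeSum G ≡ edgeCount G + edgeCount G
handshake {n} G = begin
  degreeSum G
    ≡⟨ sum-cong-≗ (λ i → trans (sum-cong-≗ (split-adj G i)) (∑-distrib-+ (up i) (λ j → up j i))) ⟩
  ∑[ i < n ] (sum (up i) + ∑[ j < n ] up j i)
    ≡⟨ ∑-distrib-+ (λ i → sum (up i)) (λ i → ∑[ j < n ] up j i) ⟩
  (∑[ i < n ] sum (up i)) + (∑[ i < n ] ∑[ j < n ] up j i)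
    ≡⟨ cong₂ _+_ (edgeCount-sum G) (trans (edgeCount-sum G) (∑-comm up)) ⟨
  edgeCount G + edgeCount G ∎
  where
  open ≡-Reasoning
  up : Fin n → Fin n → ℕ
  up i j = ⟦ adj G i j ∧ (toℕ i <ᵇ toℕ j) ⟧

-- For injective `f` this is the indicator of the image. As a sum of deltas it allows reindexing by
-- exchanging two sums.
fibre : ∀ {a n} → (Fin a → Fin n) → Fin n → ℕ
fibre {a} f x = ∑[ i < a ] δ (f i) x

fibre-∉ : ∀ {a n} {f : Fin a → Fin n} {x} → (∀ i → f i ≢ x) → fibre f x ≡ 0
fibre-∉ p = sum-zero (λ i → δ-≢ (p i))

fibre-∈ : ∀ {a n} {f : Fin a → Fin n} → (∀ i i' → f i ≡ f i' → i ≡ i') → ∀ i → fibre f (f i) ≡ 1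
fibre-∈ {suc a} {f = f} inj zero =
  cong₂ _+_ (δ-refl (f zero))
    (sum-zero {h = λ i → δ (f (suc i)) (f zero)} (λ i → δ-≢ (λ p → Fin.0≢1+n (sym (inj _ _ p)))))
fibre-∈ {suc a} {f = f} inj (suc i) =
  cong₂ _+_ (δ-≢ {i = f zero} (λ p → Fin.0≢1+n (inj _ _ p)))
    (fibre-∈ {f = f ∘ suc} (λ j k p → Fin.suc-injective (inj _ _ p)) i)

sum-reindex : ∀ {a n} (f : Fin a → Fin n) (h : Fin n → ℕ) →
  ∑[ x < n ] (fibre f x * h x) ≡ ∑[ i < a ] h (f i)
sum-reindex {a} {n} f h = begin
  ∑[ x < n ] (fibre f x * h x)
    ≡⟨ sum-cong-≗ (λ x → *-distribʳ-sum (h x) (λ i → δ (f i) x)) ⟩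
  ∑[ x < n ] ∑[ i < a ] (δ (f i) x * h x)
    ≡⟨ ∑-comm (λ x i → δ (f i) x * h x) ⟩
  ∑[ i < a ] ∑[ x < n ] (δ (f i) x * h x)
    ≡⟨ sum-cong-≗ (λ i → sum-δ (f i) h) ⟩
  ∑[ i < a ] h (f i) ∎
  where open ≡-Reasoning

sum-reindex₂ : ∀ {a n} (f : Fin a → Fin n) (h : Fin n → Fin n → ℕ) →
  ∑[ x < n ] ∑[ y < n ] (fibre f x * (fibre f y * h x y)) ≡ ∑[ i < a ] ∑[ j < a ] h (f i) (f j)
sum-reindex₂ f h =
  trans (sum-cong-≗ (λ x → trans (sym (*-distribˡ-sum (fibre f x) (λ y → fibre f y * h x y)))
                                 (cong (fibre f x *_) (sum-reindex f (h x)))))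
        (sum-reindex f _)

-- Order and edge count of a coalescence

module _ {a b N} {G : Graph a} {v : Fin a} {H : Graph b} {w : Fin b} {L : Graph N}
         (C : CoalAt G v H w L) where
  open CoalAt C

  private
    notG : ∀ {i} → i ≢ v → ∀ j → g j ≢ f i
    notG q j p = q (proj₁ (meet _ j (sym p)))

    notF : ∀ {j} → j ≢ w → ∀ i → f i ≢ g j
    notF q i p = q (proj₂ (meet i _ p))

    -- Inclusion and exclusion at a single vertex: the two images overlap in the glue vertex only.
    fibres : ∀ x → fibre f x + fibre g x ≡ 1 + δ (f v) x
    fibres x with cover x
    ... | inj₁ (i , refl) with i ≟ v
    ...   | yes refl = cong₂ _+_ (fibre-∈ f-inj v)
                (trans (cong (fibre g) glue) (trans (fibre-∈ g-inj w) (sym (δ-refl (f v)))))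
    ...   | no q = cong₂ _+_ (fibre-∈ f-inj i)
                (trans (fibre-∉ (notG q)) (sym (δ-≢ (λ p → q (sym (f-inj _ _ p))))))
    fibres x | inj₂ (j , refl) with j ≟ w
    ...   | yes refl rewrite sym glue = cong₂ _+_ (fibre-∈ f-inj v)
                (trans (cong (fibre g) glue) (trans (fibre-∈ g-inj w) (sym (δ-refl (f v)))))
    ...   | no q = trans (cong₂ _+_ (fibre-∉ (notF q)) (fibre-∈ g-inj j))
                (cong suc (sym (δ-≢ (λ p → notF q v p))))

    -- An edge with both ends in both images would be a loop at the glue vertex.
    sameG : ∀ i i' → adj L (f i) (f i') ≡ true → fibre g (f i) * (fibre g (f i') * 1) ≡ 0
    sameG i i' e with i ≟ v
    ... | no q = cong (_* (fibre g (f i') * 1)) (fibre-∉ (notG q))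
    ... | yes refl with i' ≟ v
    ...   | no q = trans (cong (λ z → fibre g (f v) * (z * 1)) (fibre-∉ (notG q)))
                         (*-zeroʳ (fibre g (f v)))
    ...   | yes refl = ⊥-elim (true≢false e (adj-irr L (f v)))

    sameH : ∀ j j' → adj L (g j) (g j') ≡ true → fibre f (g j) * (fibre f (g j') * 1) ≡ 0
    sameH j j' e with j ≟ w
    ... | no q = cong (_* (fibre f (g j') * 1)) (fibre-∉ (notF q))
    ... | yes refl with j' ≟ w
    ...   | no q = trans (cong (λ z → fibre f (g w) * (z * 1)) (fibre-∉ (notF q)))
                         (*-zeroʳ (fibre f (g w)))
    ...   | yes refl = ⊥-elim (true≢false e (adj-irr L (g w)))

    both : Fin N → Fin N → ℕ → ℕ
    both x y z = fibre f x * (fibre f y * z) + fibre g x * (fibre g y * z)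

    bothG : ∀ i i' → adj L (f i) (f i') ≡ true → 1 ≡ both (f i) (f i') 1
    bothG i i' e rewrite sameG i i' e | fibre-∈ f-inj i | fibre-∈ f-inj i' = refl

    bothH : ∀ j j' → adj L (g j) (g j') ≡ true → 1 ≡ both (g j) (g j') 1
    bothH j j' e rewrite sameH j j' e | fibre-∈ g-inj j | fibre-∈ g-inj j' = refl

    -- An edge between the two images has an end at the glue vertex, hence lies inside one image; by
    -- `sameG` and `sameH` it is counted for that image only.
    edge-split : ∀ x y → adj L x y ≡ true → 1 ≡ both x y 1
    edge-split x y e with cover x | cover y
    ... | inj₁ (i , refl) | inj₁ (i' , refl) = bothG i i' e
    ... | inj₂ (j , refl) | inj₂ (j' , refl) = bothH j j' e
    edge-split x y e | inj₁ (i , refl) | inj₂ (j , refl) with adj-fg i j e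
    ... | inj₁ refl = subst (λ z → 1 ≡ both z (g j) 1) (sym glue)
                        (bothH w j (subst (λ z → adj L z (g j) ≡ true) glue e))
    ... | inj₂ refl = subst (λ z → 1 ≡ both (f i) z 1) glue
                        (bothG i v (subst (λ z → adj L (f i) z ≡ true) (sym glue) e))
    edge-split x y e | inj₂ (j , refl) | inj₁ (i , refl)
      with adj-fg i j (trans (adj-sym L (f i) (g j)) e)
    ... | inj₁ refl = subst (λ z → 1 ≡ both (g j) z 1) (sym glue)
                        (bothH j w (subst (λ z → adj L (g j) z ≡ true) glue e))
    ... | inj₂ refl = subst (λ z → 1 ≡ both z (f i) 1) glue
                        (bothG v i (subst (λ z → adj L z (f i) ≡ true) (sym glue) e))

    adj-split : ∀ x y → ⟦ adj L x y ⟧ ≡ both x y ⟦ adj L x y ⟧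
    adj-split x y with adj L x y in e
    ... | true  = edge-split x y e
    ... | false rewrite *-zeroʳ (fibre f y) | *-zeroʳ (fibre f x)
                      | *-zeroʳ (fibre g y) | *-zeroʳ (fibre g x) = refl

  coal-order : suc N ≡ a + b
  coal-order = begin
    suc N ≡⟨ cong₂ _+_ (sum-δ (f v) (λ _ → 1)) (sum-one N) ⟨
    (∑[ x < N ] (δ (f v) x * 1)) + (∑[ x < N ] 1)
      ≡⟨ ∑-distrib-+ (λ x → δ (f v) x * 1) (λ _ → 1) ⟨
    ∑[ x < N ] (δ (f v) x * 1 + 1)
      ≡⟨ sum-cong-≗ (λ x → trans (+-comm (δ (f v) x * 1) 1)
           (trans (cong suc (*-identityʳ (δ (f v) x))) (trans (sym (fibres x))
           (sym (cong₂ _+_ (*-identityʳ (fibre f x)) (*-identityʳ (fibre g x))))))) ⟩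
    ∑[ x < N ] (fibre f x * 1 + fibre g x * 1)
      ≡⟨ ∑-distrib-+ (λ x → fibre f x * 1) (λ x → fibre g x * 1) ⟩
    (∑[ x < N ] (fibre f x * 1)) + (∑[ x < N ] (fibre g x * 1))
      ≡⟨ cong₂ _+_ (trans (sum-reindex f (λ _ → 1)) (sum-one a))
                   (trans (sum-reindex g (λ _ → 1)) (sum-one b)) ⟩
    a + b ∎
    where open ≡-Reasoning

  private
    coal-degreeSum : degreeSum L ≡ degreeSum G + degreeSum H
    coal-degreeSum = begin
      degreeSum L
        ≡⟨ sum-cong-≗ (λ x → trans (sum-cong-≗ (adj-split x)) (∑-distrib-+ (inG x) (inH x))) ⟩
      ∑[ x < N ] (sum (inG x) + sum (inH x))
        ≡⟨ ∑-distrib-+ (λ x → sum (inG x)) (λ x → sum (inH x)) ⟩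
      (∑[ x < N ] sum (inG x)) + (∑[ x < N ] sum (inH x))
        ≡⟨ cong₂ _+_ (sum-reindex₂ f (λ x y → ⟦ adj L x y ⟧)) (sum-reindex₂ g (λ x y → ⟦ adj L x y ⟧)) ⟩
      (∑[ i < a ] ∑[ i' < a ] ⟦ adj L (f i) (f i') ⟧) + (∑[ j < b ] ∑[ j' < b ] ⟦ adj L (g j) (g j') ⟧)
        ≡⟨ cong₂ _+_ (sum-cong-≗ (λ i → sum-cong-≗ (λ i' → cong ⟦_⟧ (adj-f i i'))))
                     (sum-cong-≗ (λ j → sum-cong-≗ (λ j' → cong ⟦_⟧ (adj-g j j')))) ⟩
      degreeSum G + degreeSum H ∎
      where
      open ≡-Reasoning
      inG inH : Fin N → Fin N → ℕ
      inG x y = fibre f x * (fibre f y * ⟦ adj L x y ⟧)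
      inH x y = fibre g x * (fibre g y * ⟦ adj L x y ⟧)

  coal-edgeCount : edgeCount L ≡ edgeCount G + edgeCount H
  coal-edgeCount = halve (begin
    edgeCount L + edgeCount L ≡⟨ handshake L ⟨
    degreeSum L ≡⟨ coal-degreeSum ⟩
    degreeSum G + degreeSum H ≡⟨ cong₂ _+_ (handshake G) (handshake H) ⟩
    (edgeCount G + edgeCount G) + (edgeCount H + edgeCount H)
      ≡⟨ interchange (edgeCount G) (edgeCount G) (edgeCount H) (edgeCount H) ⟩
    (edgeCount G + edgeCount H) + (edgeCount G + edgeCount H) ∎)
    where
    open ≡-Reasoning
    halve : ∀ {p q} → p + p ≡ q + q → p ≡ q
    halve {zero}  {zero}  e = refl
    halve {suc p} {suc q} e rewrite +-suc p p | +-suc q q =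
      cong suc (halve (suc-injective (suc-injective e)))

-- Cycles, embeddings and separations

close-map : ∀ {m n} (f : Fin m → Fin n) c → close (map f c) ≡ map f (close c)
close-map f []      = refl
close-map f (x ∷ c) = sym (map-++ f (x ∷ c) [ x ])

∈-close : ∀ {n} {x : Fin n} c → x ∈ close c → x ∈ c
∈-close (y ∷ c) p with ∈-++⁻ (y ∷ c) p
... | inj₁ q        = q
... | inj₂ (here q) = here q

ConsecIn-∈ : ∀ {n} (xs : List (Fin n)) {a b} → ConsecIn xs a b → (a ∈ xs) × (b ∈ xs)
ConsecIn-∈ (x ∷ y ∷ zs) (inj₁ (refl , refl))        = here refl , there (here refl)
ConsecIn-∈ (x ∷ y ∷ zs) (inj₂ (inj₁ (refl , refl))) = there (here refl) , here refl
ConsecIn-∈ (x ∷ y ∷ zs) (inj₂ (inj₂ r)) with ConsecIn-∈ (y ∷ zs) r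
... | p , q = there p , there q

CycEdge-∈ : ∀ {n} (c : List (Fin n)) {a b} → CycEdge c a b → (a ∈ c) × (b ∈ c)
CycEdge-∈ c e with ConsecIn-∈ (close c) e
... | p , q = ∈-close c p , ∈-close c q

module _ {m n} (f : Fin m → Fin n) where

  ConsecIn-map : ∀ xs {a b} → ConsecIn xs a b → ConsecIn (map f xs) (f a) (f b)
  ConsecIn-map (x ∷ y ∷ zs) (inj₁ (refl , refl))        = inj₁ (refl , refl)
  ConsecIn-map (x ∷ y ∷ zs) (inj₂ (inj₁ (refl , refl))) = inj₂ (inj₁ (refl , refl))
  ConsecIn-map (x ∷ y ∷ zs) (inj₂ (inj₂ r))             = inj₂ (inj₂ (ConsecIn-map (y ∷ zs) r))

  ConsecIn-unmap : ∀ xs {u v} → ConsecIn (map f xs) u v →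
    ∃ λ a → ∃ λ b → ConsecIn xs a b × (u ≡ f a) × (v ≡ f b)
  ConsecIn-unmap (x ∷ y ∷ zs) (inj₁ (p , q))        = x , y , inj₁ (refl , refl) , p , q
  ConsecIn-unmap (x ∷ y ∷ zs) (inj₂ (inj₁ (p , q))) = y , x , inj₂ (inj₁ (refl , refl)) , p , q
  ConsecIn-unmap (x ∷ y ∷ zs) (inj₂ (inj₂ r)) with ConsecIn-unmap (y ∷ zs) r
  ... | a , b , e , p , q = a , b , inj₂ (inj₂ e) , p , q

  CycEdge-map : ∀ c {a b} → CycEdge c a b → CycEdge (map f c) (f a) (f b)
  CycEdge-map c e rewrite close-map f c = ConsecIn-map (close c) e

  CycEdge-unmap : ∀ c {u v} → CycEdge (map f c) u v →
    ∃ λ a → ∃ λ b → CycEdge c a b × (u ≡ f a) × (v ≡ f b)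
  CycEdge-unmap c e rewrite close-map f c = ConsecIn-unmap (close c) e

  Linked-map : ∀ {G : Graph m} {H : Graph n} {P : Pred (Fin m) 0ℓ} →
    (∀ {x y} → P x → P y → adj G x y ≡ true → adj H (f x) (f y) ≡ true) →
    ∀ {xs} → All P xs → Linked G xs → Linked H (map f xs)
  Linked-map hom []                l       = tt
  Linked-map hom (p ∷ [])          l       = tt
  Linked-map hom (p ∷ ps@(q ∷ _)) (e , l) = hom p q e , Linked-map hom ps l

  module _ {P : Pred (Fin m) 0ℓ} (inj : ∀ {x y} → P x → P y → f x ≡ f y → x ≡ y) where

    private
      half : ∀ c d → All P c → All P d →
        (∀ u v → CycEdge (map f c) u v → CycEdge (map f d) u v) → ∀ a b → CycEdge c a b → CycEdge d a b
      half c d pc pd sub a b e with CycEdge-∈ c e | CycEdge-unmap d (sub _ _ (CycEdge-map c e))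
      ... | a∈ , b∈ | a' , b' , e' , p , q with CycEdge-∈ d e'
      ...   | a'∈ , b'∈ rewrite inj (All.lookup pc a∈) (All.lookup pd a'∈) p
                              | inj (All.lookup pc b∈) (All.lookup pd b'∈) q = e'

    SameCycle-unmap : ∀ {c d} → All P c → All P d → SameCycle (map f c) (map f d) → SameCycle c d
    SameCycle-unmap {c} {d} pc pd s a b =
      half c d pc pd (λ u v → proj₁ (s u v)) a b , half d c pd pc (λ u v → proj₂ (s u v)) a b

    Unique-mapOn : ∀ {xs} → All P xs → Unique xs → Unique (map f xs)
    Unique-mapOn []       []       = []
    Unique-mapOn (p ∷ ps) (q ∷ qs) =
      AllP.map⁺ (All.map (λ { (r , x≢y) e → x≢y (inj p r e) }) (All.zip (ps , q))) ∷ Unique-mapOn ps qs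

    -- The map only has to behave well on a region `P` that contains all the cycles in question.
    -- Embeddings take `P` to be everything; the colouring of the windmill is injective only on one
    -- blade with the hub.
    cycles-transfer : ∀ {k} {G : Graph m} {H : Graph n} → EdgeInAtMostCycles k H →
      (∀ {x y} → P x → P y → adj G x y ≡ true → adj H (f x) (f y) ≡ true) →
      ∀ {a b} → P a → P b → adj G a b ≡ true → ∀ cs → All (All P) cs → All (IsCycle G) cs →
      All (λ c → CycEdge c a b) cs → AllPairs (λ c d → ¬ SameCycle c d) cs → length cs ≤ k
    cycles-transfer {k} {G} {H} few hom {a} {b} pa pb ab cs ps cyc thr diff =
      subst (_≤ k) (length-map (map f) cs)
        (few (f a) (f b) (hom pa pb ab) (map (map f) cs)
          (AllP.map⁺ (All.map (λ {c} → isCycle {c}) (All.zip (ps , cyc))))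
          (AllP.map⁺ (All.map (λ {c} → CycEdge-map c) thr))
          (different ps diff))
      where
      isCycle : ∀ {c} → All P c × IsCycle G c → IsCycle H (map f c)
      isCycle {c} (pc , len , uniq , link) =
        subst (3 ≤_) (sym (length-map f c)) len ,
        Unique-mapOn pc uniq ,
        subst (Linked H) (sym (close-map f c)) (Linked-map hom (All.tabulate (λ x∈ → All.lookup pc (∈-close c x∈))) link)
      different : ∀ {cs} → All (All P) cs → AllPairs (λ c d → ¬ SameCycle c d) cs →
        AllPairs (λ c d → ¬ SameCycle c d) (map (map f) cs)
      different []       []       = []
      different (p ∷ ps) (q ∷ qs) =
        AllP.map⁺ (All.map (λ { (r , ns) s → ns (SameCycle-unmap p r s) }) (All.zip (ps , q))) ∷ different ps qs

EdgeInAtMostCycles-embed : ∀ {m n k} {G : Graph m} {H : Graph n} (f : Fin m → Fin n) →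
  (∀ i j → f i ≡ f j → i ≡ j) → (∀ i j → adj H (f i) (f j) ≡ adj G i j) →
  EdgeInAtMostCycles k H → EdgeInAtMostCycles k G
EdgeInAtMostCycles-embed f inj hom few a b ab cs =
  cycles-transfer f {P = λ _ → ⊤} (λ _ _ → inj _ _) few (λ _ _ e → trans (hom _ _) e) tt tt ab cs
    (All.universal (λ c → All.universal (λ _ → tt) c) cs)

-- Cut vertices and leaf blocks

Reach-trans : ∀ {n} {G : Graph n} {u v w} → Reach G u v → Reach G v w → Reach G u w
Reach-trans here       q = q
Reach-trans (step e p) q = step e (Reach-trans p q)

Reach-sym : ∀ {n} {G : Graph n} {u v} → Reach G u v → Reach G v u
Reach-sym         here       = here
Reach-sym {G = G} (step e p) = Reach-trans (Reach-sym p) (step (trans (adj-sym G _ _) e) here)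

data Avoiding {n} (G : Graph n) (s : Fin n) : Fin n → Fin n → Set where
  here : ∀ {u} → u ≢ s → Avoiding G s u u
  step : ∀ {u w v} → u ≢ s → adj G u w ≡ true → Avoiding G s w v → Avoiding G s u v

-- `G - s` is connected for every `s`. With this notion K₂ counts as a block, as the classification
-- requires.
NoCut : ∀ {n} → Graph n → Set
NoCut {n} G = ∀ (s u t : Fin n) → u ≢ s → t ≢ s → Avoiding G s u t

Avoiding-snoc : ∀ {n} {G : Graph n} {s u x y} → Avoiding G s u x → adj G x y ≡ true → y ≢ s → Avoiding G s u y
Avoiding-snoc (here q)     e y≢s = step q e (here y≢s)
Avoiding-snoc (step q d p) e y≢s = step q d (Avoiding-snoc p e y≢s)

-- `S` is equality for lists without repetition and `SameCycle` for lists of different cycles; both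
-- give injections out of the index set.
lookup-separates : ∀ {A : Set} {S : Rel A 0ℓ} → (∀ {x y} → S x y → S y x) →
  ∀ {xs} → AllPairs (λ x y → ¬ S x y) xs → ∀ i j → S (lookup xs i) (lookup xs j) → i ≡ j
lookup-separates S-sym {x ∷ xs} (p ∷ u) zero    zero    e = refl
lookup-separates S-sym {x ∷ xs} (p ∷ u) zero    (suc j) e = ⊥-elim (All.lookup p (∈-lookup j) e)
lookup-separates S-sym {x ∷ xs} (p ∷ u) (suc i) zero    e = ⊥-elim (All.lookup p (∈-lookup i) (S-sym e))
lookup-separates S-sym {x ∷ xs} (p ∷ u) (suc i) (suc j) e = cong suc (lookup-separates S-sym u i j e)

Unique-length : ∀ {n} {xs : List (Fin n)} → Unique xs → length xs ≤ n
Unique-length {xs = xs} u = Fin.injective⇒≤ {f = lookup xs} (lookup-separates sym u _ _)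

module _ {n} (G : Graph n) (s u : Fin n) where

  -- Grows `R` inside `G - s` until it is closed under adjacency. `k` is fuel: every round adds a
  -- new vertex, so running out would give more than `n` distinct vertices.
  closure : ∀ k R → n < length R + k → Unique R → u ∈ R → All (Avoiding G s u) R →
    ∃ λ R' → (u ∈ R') × All (Avoiding G s u) R' ×
             (∀ x y → x ∈ R' → adj G x y ≡ true → (y ∈ R') ⊎ (y ≡ s))
  closure k R n< uniq u∈ av
    with any? (λ x → any? (λ y → _∈?_ _≟_ x R ×-dec (adj G x y ≟ᵇ true) ×-dec ¬? (_∈?_ _≟_ y R ⊎-dec (y ≟ s))))
  ... | no none = R , u∈ , av , closed
    where
    closed : ∀ x y → x ∈ R → adj G x y ≡ true → (y ∈ R) ⊎ (y ≡ s)
    closed x y x∈ e with _∈?_ _≟_ y R ⊎-dec (y ≟ s)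
    ... | yes p = p
    ... | no q  = ⊥-elim (none (x , y , x∈ , e , q))
  closure zero R n< uniq u∈ av | yes _ =
    ⊥-elim (<⇒≱ n< (subst (_≤ n) (sym (+-identityʳ _)) (Unique-length uniq)))
  closure (suc k) R n< uniq u∈ av | yes (x , y , x∈ , e , q) =
    closure k (y ∷ R) (subst (n <_) (+-suc (length R) k) n<)
      (All.tabulate (λ z∈ y≡z → q (inj₁ (subst (_∈ R) (sym y≡z) z∈))) ∷ uniq) (there u∈)
      (Avoiding-snoc (All.lookup av x∈) e (λ y≡s → q (inj₂ y≡s)) ∷ av)

-- Both sides contain the cut vertex `c`, so that `G` is the coalescence of the graphs induced on
-- them. The witnesses `p` and `q` give each side a second vertex and make the other side proper.
record Separation {n} (G : Graph n) : Set₁ where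
  field
    c     : Fin n
    P Q   : Pred (Fin n) 0ℓ
    P?    : Decidable P
    Q?    : Decidable Q
    cover : ∀ x → P x ⊎ Q x
    meet  : ∀ x → P x → Q x → x ≡ c
    Pc    : P c
    Qc    : Q c
    cross : ∀ x y → P x → Q y → adj G x y ≡ true → (x ≡ c) ⊎ (y ≡ c)
    p q   : Fin n
    p≢c   : p ≢ c
    q≢c   : q ≢ c
    Pp    : P p
    Qq    : Q q

Separation-swap : ∀ {n} {G : Graph n} → Separation G → Separation G
Separation-swap {G = G} S = record
  { c = c ; P = Q ; Q = P ; P? = Q? ; Q? = P?
  ; cover = λ x → swap (cover x)
  ; meet = λ x Qx Px → meet x Px Qx
  ; Pc = Qc ; Qc = Pc
  ; cross = λ x y Qx Py e → swap (cross y x Py Qx (trans (adj-sym G y x) e))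
  ; p = q ; q = p ; p≢c = q≢c ; q≢c = p≢c ; Pp = Qq ; Qq = Pp }
  where open Separation S

-- The level of `B` is free because `Separation` quantifies over predicates and lives in `Set₁`.
search : ∀ {n ℓ} {A : Fin n → Set} {B : Set ℓ} → (∀ i → A i ⊎ B) → (∀ i → A i) ⊎ B
search {zero}  h = inj₁ (λ ())
search {suc n} h with h zero | search (h ∘ suc)
... | inj₂ b | _      = inj₂ b
... | inj₁ a | inj₂ b = inj₂ b
... | inj₁ a | inj₁ r = inj₁ (λ { zero → a ; (suc i) → r i })

Avoiding-≢ : ∀ {n} {G : Graph n} {s u t} → Avoiding G s u t → t ≢ s
Avoiding-≢ (here q)     = q
Avoiding-≢ (step _ _ p) = Avoiding-≢ p

-- If the component `R` of `u` in `G - s` misses some vertex other than `s`, then `R` with `s` and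
-- the complement of `R` are the two sides of a separation at `s`.
noCut-or-separation : ∀ {n} (G : Graph n) → NoCut G ⊎ Separation G
noCut-or-separation {n} G with search (λ s → search (λ u → from s u))
  where
  from : ∀ s u → (∀ t → u ≢ s → t ≢ s → Avoiding G s u t) ⊎ Separation G
  from s u with u ≟ s
  ... | yes u≡s = inj₁ (λ t u≢s → ⊥-elim (u≢s u≡s))
  ... | no u≢s with closure G s u n [ u ] ≤-refl ([] ∷ []) (here refl) (here u≢s ∷ [])
  ...   | R , u∈ , av , closed with any? (λ y → ¬? (_∈?_ _≟_ y R ⊎-dec (y ≟ s)))
  ...     | no none = inj₁ reach
    where
    reach : ∀ t → u ≢ s → t ≢ s → Avoiding G s u t
    reach t _ t≢s with _∈?_ _≟_ t R
    ... | yes t∈ = All.lookup av t∈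
    ... | no t∉  = ⊥-elim (none (t , λ { (inj₁ t∈) → t∉ t∈ ; (inj₂ t≡s) → t≢s t≡s }))
  ...     | yes (y , y∉) = inj₂ record
    { c = s
    ; P = λ x → (x ∈ R) ⊎ (x ≡ s)
    ; Q = _∉ R
    ; P? = λ x → _∈?_ _≟_ x R ⊎-dec (x ≟ s)
    ; Q? = λ x → ¬? (_∈?_ _≟_ x R)
    ; cover = cover
    ; meet = λ { x (inj₁ x∈) x∉ → ⊥-elim (x∉ x∈) ; x (inj₂ x≡s) _ → x≡s }
    ; Pc = inj₂ refl
    ; Qc = λ s∈ → Avoiding-≢ (All.lookup av s∈) refl
    ; cross = cross
    ; p = u ; q = y ; p≢c = u≢s ; q≢c = λ y≡s → y∉ (inj₂ y≡s)
    ; Pp = inj₁ u∈ ; Qq = λ y∈ → y∉ (inj₁ y∈) }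
    where
    cover : ∀ x → ((x ∈ R) ⊎ (x ≡ s)) ⊎ (x ∉ R)
    cover x with _∈?_ _≟_ x R
    ... | yes x∈ = inj₁ (inj₁ x∈)
    ... | no x∉  = inj₂ x∉
    cross : ∀ x y → (x ∈ R) ⊎ (x ≡ s) → y ∉ R → adj G x y ≡ true → (x ≡ s) ⊎ (y ≡ s)
    cross x y (inj₂ x≡s) y∉ e = inj₁ x≡s
    cross x y (inj₁ x∈)  y∉ e with closed x y x∈ e
    ... | inj₁ y∈  = ⊥-elim (y∉ y∈)
    ... | inj₂ y≡s = inj₂ y≡s
... | inj₁ h = inj₁ (λ s u t → h s u t)
... | inj₂ S = inj₂ S

module Induced {n} (G : Graph n) {P : Pred (Fin n) 0ℓ} (P? : Decidable P) where

  size : ℕ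
  size = length (filter P? (allFin n))

  emb : Fin size → Fin n
  emb = lookup (filter P? (allFin n))

  emb-injective : ∀ i j → emb i ≡ emb j → i ≡ j
  emb-injective = lookup-separates sym (Unique.filter⁺ P? (Unique.allFin⁺ n))

  emb-P : ∀ i → P (emb i)
  emb-P i = proj₂ (∈-filter⁻ P? {xs = allFin n} (∈-lookup i))

  emb-onto : ∀ x → P x → ∃ λ i → emb i ≡ x
  emb-onto x px = index x∈ , sym (lookup-index x∈)
    where
    x∈ : x ∈ filter P? (allFin n)
    x∈ = ∈-filter⁺ P? (∈-allFin x) px

  graph : Graph size
  graph = record
    { adj = λ i j → adj G (emb i) (emb j)
    ; adj-sym = λ i j → adj-sym G (emb i) (emb j)
    ; adj-irr = λ i → adj-irr G (emb i) }

  -- A walk in `G` from `P` to `c` can leave `P` only after visiting `c`, so cutting it at its first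
  -- visit to `c` keeps it inside.
  connected : ∀ {c} → P c → (∀ x y → P x → x ≢ c → adj G x y ≡ true → P y) → Connected G → Connected graph
  connected {c} Pc stay conn i j = Reach-trans (toC i (conn (emb i) c) refl) (Reach-sym (toC j (conn (emb j) c) refl))
    where
    c₀ : Fin size
    c₀ = proj₁ (emb-onto c Pc)
    emb-c₀ : emb c₀ ≡ c
    emb-c₀ = proj₂ (emb-onto c Pc)
    toC : ∀ i {x} → Reach G x c → emb i ≡ x → Reach graph i c₀
    toC i here ei rewrite emb-injective i c₀ (trans ei (sym emb-c₀)) = here
    toC i {x} (step {w = w} e r) refl with emb i ≟ c
    ... | yes ic rewrite emb-injective i c₀ (trans ic (sym emb-c₀)) = here
    ... | no i≢c with emb-onto w (stay _ w (emb-P i) i≢c e)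
    ...   | k , refl = step e (toC k r refl)

filter-length-≤ : ∀ {A : Set} {P Q : Pred A 0ℓ} (P? : Decidable P) (Q? : Decidable Q) →
  (∀ x → P x → Q x) → ∀ xs → length (filter P? xs) ≤ length (filter Q? xs)
filter-length-≤ P? Q? P⊆Q [] = z≤n
filter-length-≤ P? Q? P⊆Q (x ∷ xs) with P? x | Q? x
... | yes _ | yes _ = s≤s (filter-length-≤ P? Q? P⊆Q xs)
... | yes p | no ¬q = ⊥-elim (¬q (P⊆Q x p))
... | no _  | yes _ = m≤n⇒m≤1+n (filter-length-≤ P? Q? P⊆Q xs)
... | no _  | no _  = filter-length-≤ P? Q? P⊆Q xs

filter-length-< : ∀ {A : Set} {P Q : Pred A 0ℓ} (P? : Decidable P) (Q? : Decidable Q) →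
  (∀ x → P x → Q x) → ∀ {y} → Q y → ¬ P y → ∀ {xs} → y ∈ xs →
  length (filter P? xs) < length (filter Q? xs)
filter-length-< P? Q? P⊆Q {y} Qy ¬Py {_ ∷ xs} (here refl) with P? y | Q? y
... | yes p | _     = ⊥-elim (¬Py p)
... | no _  | no ¬q = ⊥-elim (¬q Qy)
... | no _  | yes _ = s≤s (filter-length-≤ P? Q? P⊆Q xs)
filter-length-< P? Q? P⊆Q Qy ¬Py {x ∷ xs} (there y∈) with P? x | Q? x
... | yes _ | yes _ = s≤s (filter-length-< P? Q? P⊆Q Qy ¬Py y∈)
... | yes p | no ¬q = ⊥-elim (¬q (P⊆Q x p))
... | no _  | yes _ = m<n⇒m<1+n (filter-length-< P? Q? P⊆Q Qy ¬Py y∈)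
... | no _  | no _  = filter-length-< P? Q? P⊆Q Qy ¬Py y∈

module Sides {n} {G : Graph n} (S : Separation G) where
  open Separation S

  module InP = Induced G P?
  module InQ = Induced G Q?

  connectedP : Connected G → Connected InP.graph
  connectedP = InP.connected Pc stay
    where
    stay : ∀ x y → P x → x ≢ c → adj G x y ≡ true → P y
    stay x y Px x≢c e with cover y
    ... | inj₁ Py = Py
    ... | inj₂ Qy with cross x y Px Qy e
    ...   | inj₁ x≡c  = ⊥-elim (x≢c x≡c)
    ...   | inj₂ refl = Pc

  c∈P : ∃ λ i → InP.emb i ≡ c
  c∈P = InP.emb-onto c Pc
  c∈Q : ∃ λ i → InQ.emb i ≡ c
  c∈Q = InQ.emb-onto c Qc

  coalescence : CoalAt InQ.graph (proj₁ c∈Q) InP.graph (proj₁ c∈P) G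
  coalescence = record
    { f = InQ.emb ; g = InP.emb
    ; f-inj = InQ.emb-injective ; g-inj = InP.emb-injective
    ; glue = trans (proj₂ c∈Q) (sym (proj₂ c∈P))
    ; meet = λ i j e →
        InQ.emb-injective _ _ (trans (meet _ (subst P (sym e) (InP.emb-P j)) (InQ.emb-P i)) (sym (proj₂ c∈Q))) ,
        InP.emb-injective _ _ (trans (meet _ (InP.emb-P j) (subst Q e (InQ.emb-P i))) (sym (proj₂ c∈P)))
    ; cover = cov
    ; adj-f = λ _ _ → refl ; adj-g = λ _ _ → refl
    ; adj-fg = cr }
    where
    cov : ∀ x → (∃ λ i → InQ.emb i ≡ x) ⊎ (∃ λ j → InP.emb j ≡ x)
    cov x with cover x
    ... | inj₁ Px = inj₂ (InP.emb-onto x Px)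
    ... | inj₂ Qx = inj₁ (InQ.emb-onto x Qx)
    cr : ∀ i j → adj G (InQ.emb i) (InP.emb j) ≡ true → (i ≡ proj₁ c∈Q) ⊎ (j ≡ proj₁ c∈P)
    cr i j e with cross (InP.emb j) (InQ.emb i) (InP.emb-P j) (InQ.emb-P i) (trans (adj-sym G _ _) e)
    ... | inj₁ ec = inj₂ (InP.emb-injective _ _ (trans ec (sym (proj₂ c∈P))))
    ... | inj₂ ec = inj₁ (InQ.emb-injective _ _ (trans ec (sym (proj₂ c∈Q))))

  sizeP : 2 ≤ InP.size
  sizeP = Unique-length {xs = proj₁ c∈P ∷ proj₁ (InP.emb-onto p Pp) ∷ []}
    (((λ e → p≢c (trans (sym (proj₂ (InP.emb-onto p Pp))) (trans (cong InP.emb (sym e)) (proj₂ c∈P)))) ∷ []) ∷ [] ∷ [])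

  -- The side of a separation of G[P] that misses c (except possibly in its own
  -- cut vertex) is a strictly smaller side of a separation of G.
  refine : (T : Separation InP.graph) → Separation.Q T (proj₁ c∈P) →
    Σ (Separation G) λ S' → Induced.size G (Separation.P? S') < InP.size
  refine T Qc₀ = record
    { c = emb T.c ; P = P″ ; Q = Q″
    ; P? = P″?
    ; Q? = λ x → Q? x ⊎-dec any? (λ i → (emb i ≟ x) ×-dec T.Q? i)
    ; cover = cover″ ; meet = meet″
    ; Pc = T.c , refl , T.Pc ; Qc = inj₂ (T.c , refl , T.Qc)
    ; cross = cross″
    ; p = emb T.p ; q = emb T.q
    ; p≢c = λ e → T.p≢c (InP.emb-injective _ _ e) ; q≢c = λ e → T.q≢c (InP.emb-injective _ _ e)
    ; Pp = T.p , refl , T.Pp ; Qq = inj₂ (T.q , refl , T.Qq) }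
    , filter-length-< P″? P? (λ { x (i , refl , _) → InP.emb-P i }) (InP.emb-P T.q)
        (λ { (i , e , Pi) → T.q≢c (T.meet T.q (subst T.P (InP.emb-injective _ _ e) Pi) T.Qq) })
        (∈-allFin (emb T.q))
    where
    module T = Separation T
    open InP using (emb)
    c₀ : Fin InP.size
    c₀ = proj₁ c∈P
    P″ Q″ : Pred (Fin n) 0ℓ
    P″ x = ∃ λ i → (emb i ≡ x) × T.P i
    Q″ x = Q x ⊎ ∃ λ i → (emb i ≡ x) × T.Q i
    P″? : Decidable P″
    P″? x = any? (λ i → (emb i ≟ x) ×-dec T.P? i)
    cover″ : ∀ x → P″ x ⊎ Q″ x
    cover″ x with cover x
    ... | inj₂ Qx = inj₂ (inj₁ Qx)
    ... | inj₁ Px with InP.emb-onto x Px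
    ...   | i , e with T.cover i
    ...     | inj₁ Pi = inj₁ (i , e , Pi)
    ...     | inj₂ Qi = inj₂ (inj₂ (i , e , Qi))
    atC : ∀ i → T.P i → emb i ≡ c → emb i ≡ emb T.c
    atC i Pi e with InP.emb-injective i c₀ (trans e (sym (proj₂ c∈P)))
    ... | refl = cong emb (T.meet i Pi Qc₀)
    meet″ : ∀ x → P″ x → Q″ x → x ≡ emb T.c
    meet″ x (i , refl , Pi) (inj₁ Qx) = atC i Pi (meet _ (InP.emb-P i) Qx)
    meet″ x (i , refl , Pi) (inj₂ (j , e , Qj)) with InP.emb-injective j i e
    ... | refl = cong emb (T.meet i Pi Qj)
    cross″ : ∀ x y → P″ x → Q″ y → adj G x y ≡ true → (x ≡ emb T.c) ⊎ (y ≡ emb T.c)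
    crossT : ∀ i j → T.P i → T.Q j → adj G (emb i) (emb j) ≡ true → (emb i ≡ emb T.c) ⊎ (emb j ≡ emb T.c)
    crossT i j Pi Qj e with T.cross i j Pi Qj e
    ... | inj₁ r = inj₁ (cong emb r)
    ... | inj₂ r = inj₂ (cong emb r)
    cross″ x y (i , refl , Pi) (inj₂ (j , refl , Qj)) e = crossT i j Pi Qj e
    -- Such an edge has `c` as an end. If it is the end in the new `P` side, it lies on both sides
    -- of `T` and is the cut vertex of `T`; if it is `y`, the edge lies within the old `P` side and
    -- `T` applies.
    cross″ x y (i , refl , Pi) (inj₁ Qy) e with cross (emb i) y (InP.emb-P i) Qy e
    ... | inj₁ r = inj₁ (atC i Pi r)
    ... | inj₂ r with trans r (sym (proj₂ c∈P))
    ...   | refl = crossT i c₀ Pi Qc₀ e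

-- Whenever the `P` side still has a cut vertex, one of its own two sides can be chosen with `c` on
-- the opposite one; it replaces `P` and is smaller. `k` bounds the number of replacements.
leafBlock : ∀ {n} {G : Graph n} k (S : Separation G) → Induced.size G (Separation.P? S) < k →
  Σ (Separation G) λ S' → NoCut (Induced.graph G (Separation.P? S'))
leafBlock {G = G} (suc k) S (s≤s <k) with noCut-or-separation (Sides.InP.graph S)
... | inj₁ nc = S , nc
... | inj₂ T with Separation.cover T (proj₁ (Sides.c∈P S))
...   | inj₂ Qc₀ = let S' , lt = Sides.refine S T Qc₀ in leafBlock k S' (≤-trans lt <k)
...   | inj₁ Pc₀ = let S' , lt = Sides.refine S (Separation-swap T) Pc₀ in leafBlock k S' (≤-trans lt <k)

-- Ear decompositions

Unique-++⁻ : ∀ {A : Set} (xs : List A) {ys} → Unique (xs ++ ys) →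
  Unique xs × Unique ys × (∀ {x} → x ∈ xs → x ∈ ys → ⊥)
Unique-++⁻ []       u       = [] , u , λ ()
Unique-++⁻ (x ∷ xs) (p ∷ u) with Unique-++⁻ xs u
... | uxs , uys , disj = AllP.++⁻ˡ xs p ∷ uxs , uys ,
  λ { (here refl) y∈ → All.lookup (AllP.++⁻ʳ xs p) y∈ refl ; (there x∈) y∈ → disj x∈ y∈ }

Unique-reverse : ∀ {A : Set} {xs : List A} → Unique xs → Unique (reverse xs)
Unique-reverse {xs = []}     u       = u
Unique-reverse {xs = x ∷ xs} (p ∷ u) rewrite unfold-reverse x xs =
  Unique.++⁺ (Unique-reverse u) ([] ∷ [])
    (λ { (x∈ , here refl) → All.lookup p (AnyP.reverse⁻ x∈) refl })

ConsecIn-sym : ∀ {n} (xs : List (Fin n)) {a b} → ConsecIn xs a b → ConsecIn xs b a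
ConsecIn-sym (x ∷ y ∷ zs) (inj₁ (p , q))        = inj₂ (inj₁ (q , p))
ConsecIn-sym (x ∷ y ∷ zs) (inj₂ (inj₁ (p , q))) = inj₁ (q , p)
ConsecIn-sym (x ∷ y ∷ zs) (inj₂ (inj₂ r))       = inj₂ (inj₂ (ConsecIn-sym (y ∷ zs) r))

data Path {n} (E : Rel (Fin n) 0ℓ) : Fin n → Fin n → List (Fin n) → Set where
  [-] : ∀ {x} → Path E x x (x ∷ [])
  _∷_ : ∀ {x y z p} → E x y → Path E y z p → Path E x z (x ∷ p)

-- An ear from `s` to `t` given by its interior vertices; the empty list is a chord.
Chain : ∀ {n} → Rel (Fin n) 0ℓ → Fin n → List (Fin n) → Fin n → Set
Chain E s []      t = E s t
Chain E s (w ∷ q) t = E s w × Chain E w q t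

first : ∀ {n} → List (Fin n) → Fin n → Fin n
first []      t = t
first (w ∷ _) t = w

-- One half of an st-order: each vertex except `z` has a neighbour later in the list. Applied to the
-- list and to its reverse, it gives both halves.
Climbs : ∀ {n} → Rel (Fin n) 0ℓ → Fin n → List (Fin n) → Set
Climbs E z []       = ⊤
Climbs E z (x ∷ xs) = ((x ≡ z) ⊎ (∃ λ y → (y ∈ xs) × E x y)) × Climbs E z xs

module _ {n} {E : Rel (Fin n) 0ℓ} where

  Path-join : ∀ {x y z w p q} → Path E x y p → E y z → Path E z w q → Path E x w (p ++ q)
  Path-join [-]     e q = e ∷ q
  Path-join (d ∷ p) e q = d ∷ Path-join p e q

  Path-chain : ∀ {s t b p} q → Chain E s q t → Path E t b p → E s (first q t) × Path E (first q t) b (q ++ p)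
  Path-chain []      e       p = e , p
  Path-chain (w ∷ q) (e , c) p with Path-chain q c p
  ... | d , r = e , d ∷ r

  Path-close : ∀ {x y p} → Path E x y p → E y x → Path E x x (close p)
  Path-close [-]         e = Path-join [-] e [-]
  Path-close r@(_ ∷ _) e = Path-join r e [-]

  Path-length : ∀ {x y p} → Path E x y p → 1 ≤ length p
  Path-length [-]     = s≤s z≤n
  Path-length (_ ∷ _) = s≤s z≤n

  Path-length₂ : ∀ {x y p} → Path E x y p → x ≢ y → 2 ≤ length p
  Path-length₂ [-]     x≢y = ⊥-elim (x≢y refl)
  Path-length₂ (_ ∷ p) x≢y = s≤s (Path-length p)

  Path-Linked : ∀ {G : Graph n} → (∀ {x y} → E x y → adj G x y ≡ true) → ∀ {x y p} → Path E x y p → Linked G p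
  Path-Linked h [-]                 = tt
  Path-Linked h (e ∷ [-])           = h e , tt
  Path-Linked h (e ∷ p@(_ ∷ _))     = h e , Path-Linked h p

  Path-last-consec : ∀ {x y z w p q} → Path E x y p → Path E z w q → ∀ r → ConsecIn ((p ++ q) ++ r) y z
  Path-last-consec [-]                 [-]     r = inj₁ (refl , refl)
  Path-last-consec [-]                 (_ ∷ _) r = inj₁ (refl , refl)
  Path-last-consec (_ ∷ p@[-])         q       r = inj₂ (inj₂ (Path-last-consec p q r))
  Path-last-consec (_ ∷ p@(_ ∷ _))     q       r = inj₂ (inj₂ (Path-last-consec p q r))

  -- Moving on to a later neighbour again and again ends in `z`, and the path never repeats a vertex
  -- because positions increase.
  climb : ∀ {z} xs → Climbs E z xs → Unique xs → ∀ {t} → t ∈ xs →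
    ∃ λ p → Path E t z p × Unique p × All (_∈ xs) p
  climb (x ∷ xs) (inj₁ refl , _) u (here refl) = x ∷ [] , [-] , [] ∷ [] , here refl ∷ []
  climb (x ∷ xs) (inj₂ (y , y∈ , e) , up) (q ∷ u) (here refl) with climb xs up u y∈
  ... | p , path , up' , sub =
    x ∷ p , e ∷ path , All.map (All.lookup q) sub ∷ up' , here refl ∷ All.map there sub
  climb (x ∷ xs) (_ , up) (q ∷ u) (there t∈) with climb xs up u t∈
  ... | p , path , up' , sub = p , path , up' , All.map there sub

  Climbs-suffix : ∀ {z} xs {ys} → Climbs E z (xs ++ ys) → Climbs E z ys
  Climbs-suffix []       c       = c
  Climbs-suffix (x ∷ xs) (_ , c) = Climbs-suffix xs c

  Climbs-insert : ∀ {z} xs qs {ys} → Climbs E z (xs ++ ys) → Climbs E z (qs ++ ys) → Climbs E z (xs ++ qs ++ ys)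
  Climbs-insert []       qs c       d = d
  Climbs-insert (x ∷ xs) qs {ys} (h , c) d = later h , Climbs-insert xs qs c d
    where
    weaken : ∀ {y} → y ∈ xs ++ ys → y ∈ xs ++ qs ++ ys
    weaken y∈ with ∈-++⁻ xs y∈
    ... | inj₁ p = ∈-++⁺ˡ p
    ... | inj₂ p = ∈-++⁺ʳ xs (∈-++⁺ʳ qs p)
    later : ∀ {z} → (x ≡ z) ⊎ (∃ λ y → (y ∈ xs ++ ys) × E x y) → (x ≡ z) ⊎ (∃ λ y → (y ∈ xs ++ qs ++ ys) × E x y)
    later (inj₁ p)            = inj₁ p
    later (inj₂ (y , y∈ , e)) = inj₂ (y , weaken y∈ , e)

  Climbs-chain : ∀ {z s t} q {ys} → Chain E s q t → t ∈ ys → Climbs E z ys → Climbs E z (q ++ ys)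
  Climbs-chain []          c            t∈ up = up
  Climbs-chain (w ∷ [])    (_ , e)      t∈ up = inj₂ (_ , t∈ , e) , up
  Climbs-chain (w ∷ x ∷ q) (_ , e , c)  t∈ up =
    inj₂ (x , here refl , e) , Climbs-chain (x ∷ q) (e , c) t∈ up

  Chain-snoc : ∀ {s w t} q → Chain E s q w → E w t → Chain E s (q ++ [ w ]) t
  Chain-snoc []      e       d = e , d
  Chain-snoc (x ∷ q) (e , c) d = e , Chain-snoc q c d

  module _ (E-sym : ∀ {x y} → E x y → E y x) where

    Path-reverse : ∀ {x y p} → Path E x y p → Path E y x (reverse p)
    Path-reverse [-] = [-]
    Path-reverse (_∷_ {x = x} {p = p} e r) rewrite unfold-reverse x p = Path-join (Path-reverse r) (E-sym e) [-]

    Chain-reverse : ∀ {s t} q → Chain E s q t → Chain E t (reverse q) s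
    Chain-reverse []      e = E-sym e
    Chain-reverse (w ∷ q) (e , c) rewrite unfold-reverse w q = Chain-snoc (reverse q) (Chain-reverse q c) (E-sym e)

    Path-consec : ∀ {x y p} → Path E x y p → ∀ {u v} → ConsecIn p u v → E u v
    Path-consec (e ∷ [-])       (inj₁ (refl , refl))        = e
    Path-consec (e ∷ (_ ∷ _))   (inj₁ (refl , refl))        = e
    Path-consec (e ∷ [-])       (inj₂ (inj₁ (refl , refl))) = E-sym e
    Path-consec (e ∷ (_ ∷ _))   (inj₂ (inj₁ (refl , refl))) = E-sym e
    Path-consec (e ∷ p@(_ ∷ _)) (inj₂ (inj₂ r))             = Path-consec p r

Climbs-mono : ∀ {n} {E E' : Rel (Fin n) 0ℓ} → (∀ {x y} → E x y → E' x y) → ∀ {z} xs → Climbs E z xs → Climbs E' z xs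
Climbs-mono h []       c                        = c
Climbs-mono h (x ∷ xs) (inj₁ p , c)             = inj₁ p , Climbs-mono h xs c
Climbs-mono h (x ∷ xs) (inj₂ (y , y∈ , e) , c) = inj₂ (y , y∈ , h e) , Climbs-mono h xs c

-- The cut between the two ends of an ear is the place where its interior enters the order.
∈-split₂ : ∀ {A : Set} {s t : A} (xs : List A) → s ≢ t → s ∈ xs → t ∈ xs →
  ∃ λ ys → ∃ λ zs → (xs ≡ ys ++ zs) × (((s ∈ ys) × (t ∈ zs)) ⊎ ((t ∈ ys) × (s ∈ zs)))
∈-split₂ (x ∷ xs) s≢t (here refl) (here refl) = ⊥-elim (s≢t refl)
∈-split₂ (x ∷ xs) s≢t (here refl) (there t∈)  = [ x ] , xs , refl , inj₁ (here refl , t∈)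
∈-split₂ (x ∷ xs) s≢t (there s∈)  (here refl) = [ x ] , xs , refl , inj₂ (here refl , s∈)
∈-split₂ (x ∷ xs) s≢t (there s∈)  (there t∈) with ∈-split₂ xs s≢t s∈ t∈
... | ys , zs , refl , inj₁ (p , q) = x ∷ ys , zs , refl , inj₁ (there p , q)
... | ys , zs , refl , inj₂ (p , q) = x ∷ ys , zs , refl , inj₂ (there p , q)

Covers : ∀ {n} → List (Fin n × Fin n) → Rel (Fin n) 0ℓ
Covers es x y = ((x , y) ∈ es) ⊎ ((y , x) ∈ es)

Covers? : ∀ {n} (es : List (Fin n × Fin n)) x y → Dec (Covers es x y)
Covers? es x y = Any.any? (pair? (x , y)) es ⊎-dec Any.any? (pair? (y , x)) es
  where
  pair? : ∀ u v → Dec (u ≡ v)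
  pair? (x , y) (x' , y') with x ≟ x' | y ≟ y'
  ... | yes refl | yes refl = yes refl
  ... | no p     | _        = no λ { refl → p refl }
  ... | _        | no p     = no λ { refl → p refl }

edgeCount-covered : ∀ {n} (G : Graph n) es → (∀ i j → adj G i j ≡ true → Covers es i j) → edgeCount G ≤ length es
edgeCount-covered {n} G es cov = ≮⇒≥ λ lt → <⇒≱ (+-mono-< lt lt) (begin
  edgeCount G + edgeCount G                ≡⟨ handshake G ⟨
  degreeSum G                              ≤⟨ sum-mono (λ i → sum-mono (bound i)) ⟩
  (∑[ i < n ] ∑[ j < n ] hits es i j)      ≡⟨ total es ⟩
  length es + length es                    ∎)
  where
  open ≤-Reasoning
  -- Every listed pair scores once in each orientation, which makes the total twice the length;
  -- repetitions in `es` only raise it.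
  hits : List (Fin n × Fin n) → Fin n → Fin n → ℕ
  hits []             i j = 0
  hits ((x , y) ∷ es) i j = (δ x i * δ y j + δ y i * δ x j) + hits es i j
  hit : ∀ es i j → Covers es i j → 1 ≤ hits es i j
  hit (_ ∷ es) i j (inj₁ (here refl)) rewrite δ-refl i | δ-refl j = s≤s z≤n
  hit ((x , y) ∷ es) i j (inj₂ (here refl)) rewrite δ-refl i | δ-refl j =
    ≤-trans (m≤n+m 1 (δ x i * δ y j)) (m≤m+n _ (hits es i j))
  hit (_ ∷ es) i j (inj₁ (there p)) = ≤-trans (hit es i j (inj₁ p)) (m≤n+m _ _)
  hit (_ ∷ es) i j (inj₂ (there p)) = ≤-trans (hit es i j (inj₂ p)) (m≤n+m _ _)
  bound : ∀ i j → ⟦ adj G i j ⟧ ≤ hits es i j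
  bound i j with adj G i j in e
  ... | true  = hit es i j (cov i j e)
  ... | false = z≤n
  one-hit : ∀ x y → ∑[ i < n ] ∑[ j < n ] (δ x i * δ y j) ≡ 1
  one-hit x y = trans (sum-cong-≗ {n} (λ i → trans (sym (*-distribˡ-sum (δ x i) (δ y)))
      (cong (δ x i *_) (trans (sum-cong-≗ {n} (λ j → sym (*-identityʳ (δ y j)))) (sum-δ y (λ _ → 1))))))
    (sum-δ x (λ _ → 1))
  sum-+₂ : ∀ (g h : Fin n → Fin n → ℕ) → ∑[ i < n ] ∑[ j < n ] (g i j + h i j) ≡
    (∑[ i < n ] ∑[ j < n ] g i j) + (∑[ i < n ] ∑[ j < n ] h i j)
  sum-+₂ g h = trans (sum-cong-≗ (λ i → ∑-distrib-+ (g i) (h i))) (∑-distrib-+ (λ i → sum (g i)) (λ i → sum (h i)))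
  total : ∀ es → ∑[ i < n ] ∑[ j < n ] hits es i j ≡ length es + length es
  total [] = sum-zero {n} (λ i → sum-zero {n} (λ _ → refl))
  total ((x , y) ∷ es) = trans
    (sum-+₂ (λ i j → δ x i * δ y j + δ y i * δ x j) (hits es))
    (trans (cong₂ _+_ (trans (sum-+₂ (λ i j → δ x i * δ y j) (λ i j → δ y i * δ x j))
                             (cong₂ _+_ (one-hit x y) (one-hit y x)))
                      (total es))
           (cong suc (sym (+-suc (length es) (length es)))))

module _ {n} (G : Graph n) {a b : Fin n} where

  chainEdges : Fin n → List (Fin n) → Fin n → List (Fin n × Fin n)
  chainEdges s []      t = [ (s , t) ]
  chainEdges s (w ∷ q) t = (s , w) ∷ chainEdges w q t

  Adj : Rel (Fin n) 0ℓ
  Adj x y = adj G x y ≡ true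

  private
    length-chainEdges : ∀ s q t → length (chainEdges s q t) ≡ suc (length q)
    length-chainEdges s []      t = refl
    length-chainEdges s (w ∷ q) t = cong suc (length-chainEdges w q t)

    Chain-covered : ∀ {s t} q {es} → (∀ {e} → e ∈ chainEdges s q t → e ∈ es) → Chain (Covers es) s q t
    Chain-covered []      h = inj₁ (h (here refl))
    Chain-covered (w ∷ q) h = inj₁ (h (here refl)) , Chain-covered q (h ∘ there)

    chainEdges-in : ∀ {s t vs} q → Chain Adj s q t → s ∈ vs → t ∈ vs → All (_∈ vs) q →
      All (λ (x , y) → (x ∈ vs) × (y ∈ vs) × Adj x y) (chainEdges s q t)
    chainEdges-in []      e       s∈ t∈ qs        = (s∈ , t∈ , e) ∷ []
    chainEdges-in (w ∷ q) (e , c) s∈ t∈ (w∈ ∷ qs) = (s∈ , w∈ , e) ∷ chainEdges-in q c w∈ t∈ qs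

  -- A subgraph (vs , es) built from the edge ab by k ears, with its vertices listed in an
  -- st-order (every vertex but b has a later neighbour, every vertex but a an earlier one),
  -- and one cycle through ab for every ear.
  record EarState (k : ℕ) : Set where
    field
      vs       : List (Fin n)
      es       : List (Fin n × Fin n)
      cs       : List (List (Fin n))
      vs-uniq  : Unique vs
      up       : Climbs (Covers es) b vs
      down     : Climbs (Covers es) a (reverse vs)
      a∈       : a ∈ vs
      b∈       : b ∈ vs
      ab∈      : Covers es a b
      es-in    : All (λ (x , y) → (x ∈ vs) × (y ∈ vs) × Adj x y) es
      count    : length es + 1 ≡ length vs + k
      cs-len   : length cs ≡ k
      cs-cycle : All (IsCycle G) cs
      cs-ab    : All (λ c → CycEdge c a b) cs
      cs-diff  : AllPairs (λ c d → ¬ SameCycle c d) cs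
      cs-old   : All (λ c → ∀ x y → CycEdge c x y → Covers es x y) cs

    covers-in : ∀ {x y} → Covers es x y → (x ∈ vs) × (y ∈ vs) × Adj x y
    covers-in (inj₁ p) = All.lookup es-in p
    covers-in (inj₂ p) = let y∈ , x∈ , e = All.lookup es-in p in x∈ , y∈ , trans (adj-sym G _ _) e

  start : Adj a b → EarState 0
  start ab = record
    { vs = a ∷ b ∷ [] ; es = [ (a , b) ] ; cs = []
    ; vs-uniq = (a≢b ∷ []) ∷ [] ∷ []
    ; up = inj₂ (b , here refl , inj₁ (here refl)) , inj₁ refl , tt
    ; down = inj₂ (a , here refl , inj₂ (here refl)) , inj₁ refl , tt
    ; a∈ = here refl ; b∈ = there (here refl) ; ab∈ = inj₁ (here refl)
    ; es-in = (here refl , there (here refl) , ab) ∷ []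
    ; count = refl ; cs-len = refl ; cs-cycle = [] ; cs-ab = [] ; cs-diff = [] ; cs-old = [] }
    where
    a≢b : a ≢ b
    a≢b refl = true≢false ab (adj-irr G a)

  module AddEar {k} (H : EarState k) where
    open EarState H

    -- The ear is oriented upwards, from `s` before the cut to `t` after it. With `q` inserted at
    -- the cut, each interior vertex has its successor on the ear above it and its predecessor below
    -- it, so the result is again an st-order.
    module Ordered {s t : Fin n} (q as bs : List (Fin n)) (split : vs ≡ as ++ bs) (s∈ : s ∈ as) (t∈ : t ∈ bs)
      (ch : Chain Adj s q t) (q-uniq : Unique q) (q∉ : All (_∉ vs) q) (fresh : q ≡ [] → ¬ Covers es s t) where

      es′ : List (Fin n × Fin n)
      es′ = chainEdges s q t ++ es

      E′ : Rel (Fin n) 0ℓ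
      E′ = Covers es′

      E′-sym : ∀ {x y} → E′ x y → E′ y x
      E′-sym = swap

      old : ∀ {x y} → Covers es x y → E′ x y
      old (inj₁ p) = inj₁ (∈-++⁺ʳ (chainEdges s q t) p)
      old (inj₂ p) = inj₂ (∈-++⁺ʳ (chainEdges s q t) p)

      ch′ : Chain E′ s q t
      ch′ = Chain-covered q ∈-++⁺ˡ

      parts : Unique as × Unique bs × (∀ {x} → x ∈ as → x ∈ bs → ⊥)
      parts = Unique-++⁻ as (subst Unique split vs-uniq)

      as⊆ : ∀ {x} → x ∈ as → x ∈ vs
      as⊆ x∈ rewrite split = ∈-++⁺ˡ x∈

      bs⊆ : ∀ {x} → x ∈ bs → x ∈ vs
      bs⊆ x∈ rewrite split = ∈-++⁺ʳ as x∈

      up-vs : Climbs E′ b (as ++ bs)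
      up-vs = subst (Climbs E′ b) split (Climbs-mono old vs up)

      down-vs : Climbs E′ a (reverse bs ++ reverse as)
      down-vs = subst (Climbs E′ a) (trans (cong reverse split) (reverse-++ as bs))
                      (Climbs-mono old (reverse vs) down)

      vs′ : List (Fin n)
      vs′ = as ++ q ++ bs

      vs⊆vs′ : ∀ {x} → x ∈ vs → x ∈ vs′
      vs⊆vs′ x∈ with ∈-++⁻ as (subst (_ ∈_) split x∈)
      ... | inj₁ p = ∈-++⁺ˡ p
      ... | inj₂ p = ∈-++⁺ʳ as (∈-++⁺ʳ q p)

      q#bs : ∀ {x} → x ∈ q → x ∈ bs → ⊥
      q#bs x∈q x∈bs = All.lookup q∉ x∈q (bs⊆ x∈bs)

      vs′-uniq : Unique vs′
      vs′-uniq = Unique.++⁺ (proj₁ parts)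
        (Unique.++⁺ q-uniq (proj₁ (proj₂ parts)) (λ (x∈q , x∈bs) → q#bs x∈q x∈bs)) disj
        where
        disj : ∀ {x} → (x ∈ as) × (x ∈ q ++ bs) → ⊥
        disj (x∈as , x∈) with ∈-++⁻ q x∈
        ... | inj₁ x∈q  = All.lookup q∉ x∈q (as⊆ x∈as)
        ... | inj₂ x∈bs = proj₂ (proj₂ parts) x∈as x∈bs

      up′ : Climbs E′ b vs′
      up′ = Climbs-insert as q up-vs (Climbs-chain q ch′ t∈ (Climbs-suffix as up-vs))

      reverse-vs′ : reverse vs′ ≡ reverse bs ++ reverse q ++ reverse as
      reverse-vs′ = trans (reverse-++ as (q ++ bs))
        (trans (cong (_++ reverse as) (reverse-++ q bs)) (++-assoc (reverse bs) (reverse q) (reverse as)))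

      down′ : Climbs E′ a (reverse vs′)
      down′ = subst (Climbs E′ a) (sym reverse-vs′)
        (Climbs-insert (reverse bs) (reverse q) down-vs
          (Climbs-chain (reverse q) (Chain-reverse E′-sym q ch′) (AnyP.reverse⁺ s∈)
            (Climbs-suffix (reverse bs) down-vs)))

      -- The ascent stays within `bs` and the descent within `as`. Being on different sides of the
      -- cut, they are disjoint, which makes the closed walk a cycle.
      upper : ∃ λ p → Path E′ t b p × Unique p × All (_∈ bs) p
      upper = climb bs (Climbs-suffix as up-vs) (proj₁ (proj₂ parts)) t∈

      lower : ∃ λ p → Path E′ s a p × Unique p × All (_∈ reverse as) p
      lower = climb (reverse as) (Climbs-suffix (reverse bs) down-vs) (Unique-reverse (proj₁ parts)) (AnyP.reverse⁺ s∈)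

      p₁ p₂ cyc : List (Fin n)
      p₁ = reverse (proj₁ lower)
      p₂ = proj₁ upper
      cyc = p₁ ++ (q ++ p₂)

      path₁ : Path E′ a s p₁
      path₁ = Path-reverse E′-sym (proj₁ (proj₂ lower))

      path₂ : Path E′ t b p₂
      path₂ = proj₁ (proj₂ upper)

      ear : E′ s (first q t) × Path E′ (first q t) b (q ++ p₂)
      ear = Path-chain q ch′ path₂

      path : Path E′ a b cyc
      path = Path-join path₁ (proj₁ ear) (proj₂ ear)

      closed : Path E′ a a (close cyc)
      closed = Path-close path (E′-sym (old ab∈))

      es′-in : All (λ (x , y) → (x ∈ vs′) × (y ∈ vs′) × Adj x y) es′
      es′-in = AllP.++⁺
        (chainEdges-in q ch (vs⊆vs′ (as⊆ s∈)) (vs⊆vs′ (bs⊆ t∈))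
          (All.tabulate (λ x∈ → ∈-++⁺ʳ as (∈-++⁺ˡ x∈))))
        (All.map (λ (x∈ , y∈ , e) → vs⊆vs′ x∈ , vs⊆vs′ y∈ , e) es-in)

      E′-adj : ∀ {x y} → E′ x y → Adj x y
      E′-adj (inj₁ p) = proj₂ (proj₂ (All.lookup es′-in p))
      E′-adj (inj₂ p) = trans (adj-sym G _ _) (proj₂ (proj₂ (All.lookup es′-in p)))

      -- A longer ear leaves `vs` with its first edge, and a chord is uncovered by assumption.
      -- Earlier cycles use covered edges only (`cs-old`), so this edge tells the new cycle from all
      -- of them.
      new-edge : ¬ Covers es s (first q t)
      new-edge = go q q∉ fresh
        where
        go : ∀ q → All (_∉ vs) q → (q ≡ [] → ¬ Covers es s t) → ¬ Covers es s (first q t)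
        go []      _        f = f refl
        go (w ∷ _) (w∉ ∷ _) f = λ c → w∉ (proj₁ (proj₂ (covers-in c)))

      new-consec : CycEdge cyc s (first q t)
      new-consec = Path-last-consec path₁ (proj₂ ear) (take 1 cyc)

      cyc-ab : CycEdge cyc a b
      cyc-ab = ConsecIn-sym (close cyc) (last path)
        where
        last : ∀ {x y p} → Path E′ x y p → ConsecIn (close p) y x
        last [-] = inj₁ (refl , refl)
        last {y = y} r@(_∷_ {x = x} {p = p} _ _) =
          subst (λ l → ConsecIn l y x) (++-assoc (x ∷ p) [ x ] []) (Path-last-consec {E = E′} r [-] [])

      cyc-length : 3 ≤ length cyc
      cyc-length = subst (3 ≤_)
        (sym (trans (length-++ p₁) (cong (length p₁ +_) (length-++ q)))) (go q fresh)
        where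
        go : ∀ q → (q ≡ [] → ¬ Covers es s t) → 3 ≤ length p₁ + (length q + length p₂)
        go (_ ∷ q) f = +-mono-≤ (Path-length path₁) (s≤s (≤-trans (Path-length path₂) (m≤n+m _ (length q))))
        go [] f with a ≟ s | t ≟ b
        ... | no a≢s | _      = +-mono-≤ (Path-length₂ path₁ a≢s) (Path-length path₂)
        ... | yes _  | no t≢b = +-mono-≤ (Path-length path₁) (Path-length₂ path₂ t≢b)
        -- If ascent and descent were both trivial, the chord would be `ab`, which is covered from
        -- the start.
        ... | yes p  | yes p′ = ⊥-elim (f refl (subst (λ x → Covers es x t) p (subst (Covers es a) (sym p′) ab∈)))

      cyc-uniq : Unique cyc
      cyc-uniq = Unique.++⁺ (Unique-reverse (proj₁ (proj₂ (proj₂ lower))))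
        (Unique.++⁺ q-uniq (proj₁ (proj₂ (proj₂ upper)))
          (λ (x∈q , x∈p) → q#bs x∈q (All.lookup (proj₂ (proj₂ (proj₂ upper))) x∈p)))
        disj
        where
        in-as : ∀ {x} → x ∈ p₁ → x ∈ as
        in-as x∈ = AnyP.reverse⁻ (All.lookup (proj₂ (proj₂ (proj₂ lower))) (AnyP.reverse⁻ x∈))
        disj : ∀ {x} → (x ∈ p₁) × (x ∈ q ++ p₂) → ⊥
        disj (x∈₁ , x∈) with ∈-++⁻ q x∈
        ... | inj₁ x∈q = All.lookup q∉ x∈q (as⊆ (in-as x∈₁))
        ... | inj₂ x∈₂ = proj₂ (proj₂ parts) (in-as x∈₁) (All.lookup (proj₂ (proj₂ (proj₂ upper))) x∈₂)

      count′ : length es′ + 1 ≡ length vs′ + suc k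
      count′ rewrite length-++ (chainEdges s q t) {es} | length-chainEdges s q t
        | length-++ as {q ++ bs} | length-++ q {bs} = begin
        suc (length q + length es) + 1            ≡⟨ cong suc (+-assoc (length q) (length es) 1) ⟩
        suc (length q + (length es + 1))          ≡⟨ cong (λ z → suc (length q + z)) count ⟩
        suc (length q + (length vs + k))          ≡⟨ cong (λ z → suc (length q + (z + k))) (trans (cong length split) (length-++ as)) ⟩
        suc (length q + (length as + length bs + k)) ≡⟨ cong suc (+-assoc (length q) (length as + length bs) k) ⟨
        suc (length q + (length as + length bs) + k) ≡⟨ +-suc (length q + (length as + length bs)) k ⟨
        length q + (length as + length bs) + suc k ≡⟨ cong (_+ suc k) (x∙yz≈y∙xz (length q) (length as) (length bs)) ⟩
        length as + (length q + length bs) + suc k ∎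
        where open ≡-Reasoning

      next : EarState (suc k)
      next = record
        { vs = vs′ ; es = es′ ; cs = cyc ∷ cs
        ; vs-uniq = vs′-uniq ; up = up′ ; down = down′
        ; a∈ = vs⊆vs′ a∈ ; b∈ = vs⊆vs′ b∈ ; ab∈ = old ab∈
        ; es-in = es′-in
        ; count = count′
        ; cs-len = cong suc cs-len
        ; cs-cycle = (cyc-length , cyc-uniq , Path-Linked E′-adj closed) ∷ cs-cycle
        ; cs-ab = cyc-ab ∷ cs-ab
        ; cs-diff = All.map (λ od same → new-edge (od _ _ (proj₁ (same _ _) new-consec))) cs-old ∷ cs-diff
        ; cs-old = (λ x y → Path-consec E′-sym closed) ∷ All.map (λ od x y c → old (od x y c)) cs-old }

    addEar : ∀ {s t} q → s ≢ t → s ∈ vs → t ∈ vs → Chain Adj s q t → Unique q → All (_∉ vs) q →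
      (q ≡ [] → ¬ Covers es s t) → EarState (suc k)
    addEar {s} {t} q s≢t s∈ t∈ ch qu q∉ fresh with ∈-split₂ vs s≢t s∈ t∈
    ... | as , bs , split , inj₁ (s∈as , t∈bs) = Ordered.next q as bs split s∈as t∈bs ch qu q∉ fresh
    ... | as , bs , split , inj₂ (t∈as , s∈bs) =
      Ordered.next (reverse q) as bs split t∈as s∈bs (Chain-reverse (trans (adj-sym G _ _)) q ch) (Unique-reverse qu)
        (All.tabulate (λ x∈ → All.lookup q∉ (AnyP.reverse⁻ x∈)))
        (λ rq≡[] c → fresh (trans (sym (reverse-involutive q)) (cong reverse rq≡[])) (swap c))

    shortcut : ∀ {u w t} q → u ∈ w ∷ q → Chain Adj w q t → Unique (w ∷ q) → All (_∉ vs) (w ∷ q) →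
      ∃ λ q' → Chain Adj u q' t × Unique (u ∷ q') × All (_∉ vs) (u ∷ q')
    shortcut q       (here refl) c       uq       q∉       = q , c , uq , q∉
    shortcut (x ∷ q) (there u∈)  (_ , c) (_ ∷ uq) (_ ∷ q∉) = shortcut q u∈ c uq q∉

    Avoiding-start : ∀ {s u t} → Avoiding G s u t → u ≢ s
    Avoiding-start (here q)     = q
    Avoiding-start (step q _ _) = q

    -- Stops the walk at its first vertex in `vs` and removes loops by `shortcut`. As the walk
    -- avoids `s`, the ear so obtained ends at a vertex different from `s`.
    firstHit : ∀ {s u z} → Avoiding G s u z → z ∈ vs → u ∉ vs →
      ∃ λ q → ∃ λ t → Chain Adj u q t × Unique (u ∷ q) × All (_∉ vs) (u ∷ q) × (t ∈ vs) × (t ≢ s)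
    firstHit (here _) z∈ u∉ = ⊥-elim (u∉ z∈)
    firstHit {u = u} (step {w = w} _ e r) z∈ u∉ with _∈?_ _≟_ w vs
    ... | yes w∈ = [] , w , e , [] ∷ [] , u∉ ∷ [] , w∈ , Avoiding-start r
    ... | no w∉ with firstHit r z∈ w∉
    ...   | q , t , c , uq , q∉ , t∈ , t≢s with _∈?_ _≟_ u (w ∷ q)
    ...     | yes u∈ = let q' , c' , uq' , q∉' = shortcut q u∈ c uq q∉ in q' , t , c' , uq' , q∉' , t∈ , t≢s
    ...     | no ∉q = w ∷ q , t , (e , c) , All.tabulate (λ x∈ u≡x → ∉q (subst (_∈ w ∷ q) (sym u≡x) x∈)) ∷ uq
                      , u∉ ∷ q∉ , t∈ , t≢s

    other : ∀ s → a ≢ b → ∃ λ z → (z ∈ vs) × (z ≢ s)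
    other s a≢b with a ≟ s
    ... | no a≢s   = a , a∈ , a≢s
    ... | yes refl = b , b∈ , λ b≡a → a≢b (sym b≡a)

    -- An uncovered edge `su` is a chord if `u` is in `vs`. Otherwise `G - s` is connected, so `u`
    -- can be joined to another vertex of `vs` without returning to `s`, which completes an ear.
    extend : NoCut G → ∀ s u → s ∈ vs → Adj s u → ¬ Covers es s u → EarState (suc k)
    extend nc s u s∈ e ¬c with _∈?_ _≟_ u vs
    ... | yes u∈ = addEar [] s≢u s∈ u∈ e [] [] (λ _ → ¬c)
      where
      s≢u : s ≢ u
      s≢u refl = true≢false e (adj-irr G s)
    ... | no u∉ with other s a≢b
      where
      a≢b : a ≢ b
      a≢b refl = true≢false (proj₂ (proj₂ (covers-in ab∈))) (adj-irr G a)
    ...   | z , z∈ , z≢s with firstHit (nc s u z (λ { refl → u∉ s∈ }) z≢s) z∈ u∉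
    ...     | q , t , c , uq , q∉ , t∈ , t≢s =
      addEar (u ∷ q) (λ s≡t → t≢s (sym s≡t)) s∈ t∈ (e , c) uq q∉ (λ ())

  module _ {m} (conn : Connected G) (nc : NoCut G) (few : EdgeInAtMostCycles m G) where

    -- `j` counts the ears that may still be added: with `m + 1` ears there would be `m + 1`
    -- different cycles through `ab`. If no ear can be added, all edges at `vs` are covered, so
    -- connectivity puts every edge into `es`.
    ears : ∀ j {k} → k + j ≡ suc m → EarState k → edgeCount G + 1 ≤ n + m
    ears zero {k} eq H = ⊥-elim (<⇒≱ (s≤s ≤-refl)
      (subst (_≤ m) (trans cs-len (trans (sym (+-identityʳ k)) eq))
        (few a b (proj₂ (proj₂ (covers-in ab∈))) cs cs-cycle cs-ab cs-diff)))
      where open EarState H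
    ears (suc j) {k} eq H
      with any? (λ s → any? (λ u → _∈?_ _≟_ s (EarState.vs H) ×-dec (adj G s u ≟ᵇ true) ×-dec ¬? (Covers? (EarState.es H) s u)))
    ... | yes (s , u , s∈ , e , ¬c) = ears j (trans (sym (+-suc k j)) eq) (AddEar.extend H nc s u s∈ e ¬c)
    ... | no none = begin
      edgeCount G + 1 ≤⟨ +-monoˡ-≤ 1 (edgeCount-covered G es (λ i j → covered (all∈ a∈ (conn a i)))) ⟩
      length es + 1   ≡⟨ count ⟩
      length vs + k   ≤⟨ +-mono-≤ (Unique-length vs-uniq) (≤-pred (subst (suc k ≤_) eq (subst (_≤ k + suc j) (+-comm k 1) (+-monoʳ-≤ k (s≤s z≤n))))) ⟩
      n + m ∎
      where
      open EarState H
      open ≤-Reasoning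
      covered : ∀ {x y} → x ∈ vs → Adj x y → Covers es x y
      covered {x} {y} x∈ e with Covers? es x y
      ... | yes c = c
      ... | no ¬c = ⊥-elim (none (x , y , x∈ , e , ¬c))
      all∈ : ∀ {x y} → x ∈ vs → Reach G x y → y ∈ vs
      all∈ x∈ here       = x∈
      all∈ x∈ (step e r) = all∈ (proj₁ (proj₂ (covers-in (covered x∈ e)))) r

-- Every ear yields a further cycle through a given edge, so the cyclomatic number is at most m.
edgeCount-noCut : ∀ {n m} (G : Graph n) → 2 ≤ n → Connected G → NoCut G → EdgeInAtMostCycles m G →
  edgeCount G + 1 ≤ n + m
edgeCount-noCut {suc zero} G (s≤s ())
edgeCount-noCut {suc (suc n)} {m} G _ conn nc few with conn zero (suc zero)
... | step {w = w} e _ = ears G conn nc few (suc m) refl (start G e)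

-- Small blocks

-- The strict upper triangle of an adjacency matrix: plain data in which symmetry and absence of
-- loops are automatic, so that graphs can be enumerated.
Tri : ℕ → Set
Tri zero    = ⊤
Tri (suc n) = Vec Bool n × Tri n

triAdj : ∀ {n} → Tri n → Fin n → Fin n → Bool
triAdj (r , t) zero    zero    = false
triAdj (r , t) zero    (suc j) = lookupᵛ r j
triAdj (r , t) (suc i) zero    = lookupᵛ r i
triAdj (r , t) (suc i) (suc j) = triAdj t i j

triGraph : ∀ {n} → Tri n → Graph n
triGraph t = record { adj = triAdj t ; adj-sym = symm t ; adj-irr = irr t }
  where
  symm : ∀ {n} (t : Tri n) i j → triAdj t i j ≡ triAdj t j i
  symm t       zero    zero    = refl
  symm t       zero    (suc j) = refl
  symm t       (suc i) zero    = refl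
  symm (r , t) (suc i) (suc j) = symm t i j
  irr : ∀ {n} (t : Tri n) i → triAdj t i i ≡ false
  irr t       zero    = refl
  irr (r , t) (suc i) = irr t i

triangle : ∀ {n} → (Fin n → Fin n → Bool) → Tri n
triangle {zero}  A = tt
triangle {suc n} A = tabulateᵛ (λ j → A zero (suc j)) , triangle (λ i j → A (suc i) (suc j))

triAdj-triangle : ∀ {n} (A : Fin n → Fin n → Bool) → (∀ i j → A i j ≡ A j i) → (∀ i → A i i ≡ false) →
  ∀ i j → triAdj (triangle A) i j ≡ A i j
triAdj-triangle A s r zero    zero    = sym (r zero)
triAdj-triangle A s r zero    (suc j) = lookup∘tabulate (λ j → A zero (suc j)) j
triAdj-triangle A s r (suc i) zero    = trans (lookup∘tabulate (λ j → A zero (suc j)) i) (s zero (suc i))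
triAdj-triangle A s r (suc i) (suc j) =
  triAdj-triangle (λ i j → A (suc i) (suc j)) (λ i j → s (suc i) (suc j)) (r ∘ suc) i j

rowCount : ∀ {m} → Vec Bool m → ℕ
rowCount []      = 0
rowCount (b ∷ v) = ⟦ b ⟧ + rowCount v

triCount : ∀ {n} → Tri n → ℕ
triCount {zero}  t       = 0
triCount {suc n} (r , t) = rowCount r + triCount t

triCount-triangle : ∀ {n} (A : Fin n → Fin n → Bool) →
  ∑[ i < n ] ∑[ j < n ] ⟦ A i j ∧ (toℕ i <ᵇ toℕ j) ⟧ ≡ triCount (triangle A)
triCount-triangle {zero}  A = refl
triCount-triangle {suc n} A = cong₂ _+_
  (cong₂ _+_ (cong ⟦_⟧ (∧-zeroʳ (A zero zero)))
    (trans (sum-cong-≗ (λ j → cong ⟦_⟧ (∧-identityʳ (A zero (suc j))))) (row (λ j → A zero (suc j)))))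
  (trans (sum-cong-≗ (λ i → cong (_+ ∑[ j < n ] ⟦ A (suc i) (suc j) ∧ (toℕ i <ᵇ toℕ j) ⟧)
                                 (cong ⟦_⟧ (∧-zeroʳ (A (suc i) zero)))))
         (triCount-triangle (λ i j → A (suc i) (suc j))))
  where
  row : ∀ {m} (h : Fin m → Bool) → ∑[ j < m ] ⟦ h j ⟧ ≡ rowCount (tabulateᵛ h)
  row {zero}  h = refl
  row {suc m} h = cong (⟦ h zero ⟧ +_) (row (h ∘ suc))

-- The budget k counts edges: only the graphs with exactly k edges are tested.
allRow : ∀ m → ℕ → (ℕ → Vec Bool m → Bool) → Bool
allRow zero    k       P = P k []
allRow (suc m) zero    P = allRow m zero (λ k v → P k (false ∷ v))
allRow (suc m) (suc k) P =
  allRow m k (λ k' v → P k' (true ∷ v)) ∧ allRow m (suc k) (λ k' v → P k' (false ∷ v))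

allTri : ∀ n → ℕ → (Tri n → Bool) → Bool
allTri zero    zero    P = P tt
allTri zero    (suc k) P = true
allTri (suc n) k       P = allRow n k (λ k' v → allTri n k' (λ t → P (v , t)))

∧-true : ∀ {b c} → b ∧ c ≡ true → (b ≡ true) × (c ≡ true)
∧-true {true} e = refl , e

allRow-sound : ∀ m k {P} → allRow m k P ≡ true → ∀ v k' → rowCount v + k' ≡ k → P k' v ≡ true
allRow-sound zero    k       e []          k' refl = e
allRow-sound (suc m) zero    e (false ∷ v) k' p    = allRow-sound m zero e v k' p
allRow-sound (suc m) (suc k) e (true ∷ v)  k' p    = allRow-sound m k (proj₁ (∧-true e)) v k' (suc-injective p)
allRow-sound (suc m) (suc k) {P} e (false ∷ v) k' p =
  allRow-sound m (suc k) (proj₂ (∧-true {allRow m k (λ k' v → P k' (true ∷ v))} e)) v k' p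

allTri-sound : ∀ n k {P} → allTri n k P ≡ true → ∀ t → triCount t ≡ k → P t ≡ true
allTri-sound zero    zero e t       p = e
allTri-sound (suc n) k    e (r , t) p = allTri-sound n (triCount t) (allRow-sound n k e r (triCount t) p) t refl

does-true : ∀ {A : Set} (d : Dec A) → does d ≡ true → A
does-true (yes a) _ = a
does-true (no _)  ()

every? : ∀ {n} {P : Pred (Fin n) 0ℓ} → Decidable P → Dec (∀ i → P i)
every? {zero}  P? = yes λ ()
every? {suc n} P? = map′ (λ { (p , ps) zero → p ; (p , ps) (suc i) → ps i }) (λ ps → ps zero , ps ∘ suc)
                         (P? zero ×-dec every? (P? ∘ suc))

picks : ∀ {A : Set} → List A → List (A × List A)
picks []       = []
picks (x ∷ xs) = (x , xs) ∷ map (λ (y , ys) → y , x ∷ ys) (picks xs)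

perms : ∀ {A : Set} → ℕ → List A → List (List A)
perms zero    xs = [ [] ]
perms (suc k) xs = concatMap (λ (y , ys) → map (y ∷_) (perms k ys)) (picks xs)

entry : ∀ {n m} → List (Fin n) → Fin n → Fin m → Fin n
entry []       d i       = d
entry (x ∷ xs) d zero    = x
entry (x ∷ xs) d (suc i) = entry xs d i

edgesOf : ∀ {n} → List (Fin n) → List (Fin n × Fin n)
edgesOf []           = []
edgesOf (x ∷ [])     = []
edgesOf (x ∷ y ∷ zs) = (x , y) ∷ edgesOf (y ∷ zs)

edgesOf-ConsecIn : ∀ {n} (l : List (Fin n)) → All (λ (x , y) → ConsecIn l x y) (edgesOf l)
edgesOf-ConsecIn []           = []
edgesOf-ConsecIn (x ∷ [])     = []
edgesOf-ConsecIn (x ∷ y ∷ zs) = inj₁ (refl , refl) ∷ All.map (λ r → inj₂ (inj₂ r)) (edgesOf-ConsecIn (y ∷ zs))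

ConsecIn? : ∀ {n} (l : List (Fin n)) a b → Dec (ConsecIn l a b)
ConsecIn? []           a b = no λ ()
ConsecIn? (x ∷ [])     a b = no λ ()
ConsecIn? (x ∷ y ∷ zs) a b =
  ((a ≟ x) ×-dec (b ≟ y)) ⊎-dec ((a ≟ y) ×-dec (b ≟ x)) ⊎-dec ConsecIn? (y ∷ zs) a b

-- One direction suffices, since the edge set of a cycle is never properly contained in that of
-- another cycle.
Novel : ∀ {n} → List (Fin n) → List (Fin n) → Set
Novel c d = ¬ All (λ (x , y) → CycEdge d x y) (edgesOf (close c))

Novel⇒¬SameCycle : ∀ {n} {c d : List (Fin n)} → Novel c d → ¬ SameCycle c d
Novel⇒¬SameCycle {c = c} nov same = nov (All.map (λ e → proj₁ (same _ _) e) (edgesOf-ConsecIn (close c)))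

module Small {n} (G : Graph n) where

  Linked? : ∀ l → Dec (Linked G l)
  Linked? []           = yes tt
  Linked? (x ∷ [])     = yes tt
  Linked? (x ∷ y ∷ zs) = (adj G x y ≟ᵇ true) ×-dec Linked? (y ∷ zs)

  IsCycle? : ∀ c → Dec (IsCycle G c)
  IsCycle? c = (3 ≤? length c) ×-dec unique? _≟_ c ×-dec Linked? (close c)

  mutual
    returns : ℕ → Fin n → Fin n → List (Fin n) → List (List (Fin n))
    returns zero    a u free = []
    returns (suc k) a u free = returnsVia k a u (picks free)

    returnsVia : ℕ → Fin n → Fin n → List (Fin n × List (Fin n)) → List (List (Fin n))
    returnsVia k a u []               = []
    returnsVia k a u ((w , free) ∷ ps) =
      (if adj G u w
       then (if adj G w a then [ [ w ] ] else []) ++ map (w ∷_) (returns k a w free)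
       else [])
      ++ returnsVia k a u ps

  cyclesThrough : Fin n → Fin n → List (List (Fin n))
  cyclesThrough a b =
    map (λ l → a ∷ b ∷ l) (returns n a b (filter (λ x → ¬? (x ≟ a ⊎-dec x ≟ b)) (allFin n)))

  -- The cycles found by the search are validated, so the search itself needs no correctness proof.
  Overloaded : ℕ → Fin n → Fin n → Set
  Overloaded k a b = (adj G a b ≡ true) × (k < length cs) ×
    All (IsCycle G) cs × All (λ c → CycEdge c a b) cs × AllPairs Novel cs
    where
    cs = take (suc k) (cyclesThrough a b)

  Overloaded? : ∀ k a b → Dec (Overloaded k a b)
  Overloaded? k a b = (adj G a b ≟ᵇ true) ×-dec (suc k ≤? length cs) ×-dec
    All.all? IsCycle? cs ×-dec All.all? (λ c → ConsecIn? (close c) a b) cs ×-dec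
    AllPairs.allPairs? (λ c d → ¬? (All.all? (λ (x , y) → ConsecIn? (close d) x y) (edgesOf (close c)))) cs
    where
    cs = take (suc k) (cyclesThrough a b)

  Overloaded-absurd : ∀ {k a b} → EdgeInAtMostCycles k G → ¬ Overloaded k a b
  Overloaded-absurd few (e , len , cyc , thr , nov) =
    <⇒≱ len (few _ _ e _ cyc thr (AllPairs.map (λ {c} {d} → Novel⇒¬SameCycle {c = c} {d}) nov))

  Behind : Fin n → Fin n → Fin n → Fin n → Set
  Behind s u w y = (y ≡ s) ⊎ (y ≡ u) ⊎ (y ≡ w)

  Behind? : ∀ s u w y → Dec (Behind s u w y)
  Behind? s u w y = (y ≟ s) ⊎-dec (y ≟ u) ⊎-dec (y ≟ w)

  -- u ≡ w is allowed: it covers the vertices of degree at most one.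
  CutOff : Fin n → Fin n → Fin n → Set
  CutOff s u w = (u ≢ s) × (w ≢ s) ×
    (∀ y → adj G u y ≡ true → Behind s u w y) × (∀ y → adj G w y ≡ true → Behind s u w y) ×
    ∃ λ y → ¬ Behind s u w y

  CutOff? : ∀ s u w → Dec (CutOff s u w)
  CutOff? s u w = ¬? (u ≟ s) ×-dec ¬? (w ≟ s) ×-dec
    every? (λ y → (adj G u y ≟ᵇ true) →-dec Behind? s u w y) ×-dec
    every? (λ y → (adj G w y ≟ᵇ true) →-dec Behind? s u w y) ×-dec
    any? (λ y → ¬? (Behind? s u w y))

  -- A walk from `u` that avoids `s` can only alternate between `u` and `w`. Testing sets of at most
  -- two vertices is enough on six vertices: `G - s` has at most five, so if it is disconnected,
  -- some component has at most two.
  CutOff-absurd : NoCut G → ∀ {s u w} → ¬ CutOff s u w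
  CutOff-absurd nc {s} {u} {w} (u≢s , w≢s , Nu , Nw , y , y∉) =
    stuck (nc s u y u≢s (λ y≡s → y∉ (inj₁ y≡s))) (inj₁ refl) y∉
    where
    stuck : ∀ {x y} → Avoiding G s x y → (x ≡ u) ⊎ (x ≡ w) → ¬ Behind s u w y → ⊥
    next : ∀ {x y} → Avoiding G s x y → Behind s u w x → ¬ Behind s u w y → ⊥
    next (here x≢s)     (inj₁ x≡s) y∉ = x≢s x≡s
    next (step x≢s _ _) (inj₁ x≡s) y∉ = x≢s x≡s
    next r              (inj₂ x∈)  y∉ = stuck r x∈ y∉
    stuck (here _)     x∈          y∉ = y∉ (inj₂ x∈)
    stuck (step _ e r) (inj₁ refl) y∉ = next r (Nu _ e) y∉
    stuck (step _ e r) (inj₂ refl) y∉ = next r (Nw _ e) y∉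

  -- Bijectivity is tested along with adjacency, so nothing has to be known about `perms`. Its lists
  -- have `n` entries here, and the default of `entry` is never reached.
  Matches : Graph n → List (Fin n) → Set
  Matches X p = (∀ i j → adj G (at i) (at j) ≡ adj X i j) ×
    (∀ j → ∃ λ i → at i ≡ j) × (∀ i j → at i ≡ at j → i ≡ j)
    where
    at : Fin n → Fin n
    at i = entry p i i

  Matches? : ∀ X p → Dec (Matches X p)
  Matches? X p = every? (λ i → every? (λ j → adj G (at i) (at j) ≟ᵇ adj X i j)) ×-dec
    every? (λ j → any? (λ i → at i ≟ j)) ×-dec every? (λ i → every? (λ j → (at i ≟ at j) →-dec (i ≟ j)))
    where
    at : Fin n → Fin n
    at i = entry p i i

  Matches-Iso : ∀ {X p} → Matches X p → Iso X G
  Matches-Iso {p = p} (hom , onto , inj) = record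
    { to = λ i → entry p i i ; from = λ j → proj₁ (onto j)
    ; from-to = λ i → inj _ _ (proj₂ (onto _)) ; to-from = λ j → proj₂ (onto j)
    ; adj-pres = hom }

  Classified : ℕ → List (Graph n) → Set
  Classified k Xs = (∃ λ a → ∃ λ b → Overloaded k a b) ⊎ (∃ λ s → ∃ λ u → ∃ λ w → CutOff s u w) ⊎
    Any (λ X → Any (Matches X) (perms n (allFin n))) Xs

  Classified? : ∀ k Xs → Dec (Classified k Xs)
  Classified? k Xs = any? (λ a → any? (λ b → Overloaded? k a b)) ⊎-dec
    any? (λ s → any? (λ u → any? (λ w → CutOff? s u w))) ⊎-dec
    Any.any? (λ X → Any.any? (Matches? X) (perms n (allFin n))) Xs

checkAll : ∀ n → ℕ → List (Graph n) → Bool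
checkAll n e Xs = allTri n e (λ t → does (Small.Classified? (triGraph t) 4 Xs))

-- A data type rather than an equation, so that comparing two instances never reruns the computation.
data Checked (n e : ℕ) (Xs : List (Graph n)) : Set where
  checked : checkAll n e Xs ≡ true → Checked n e Xs

module _ {n} {G H : Graph n} (same : ∀ i j → adj H i j ≡ adj G i j) where

  NoCut-cong : NoCut G → NoCut H
  NoCut-cong nc s u t u≢s t≢s = go (nc s u t u≢s t≢s)
    where
    go : ∀ {u t} → Avoiding G s u t → Avoiding H s u t
    go (here q)     = here q
    go (step q e r) = step q (trans (same _ _) e) (go r)

  Iso-cong : ∀ {m} {X : Graph m} → Iso X H → Iso X G
  Iso-cong i = record
    { to = to ; from = from ; from-to = from-to ; to-from = to-from
    ; adj-pres = λ i j → trans (sym (same _ _)) (adj-pres i j) }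
    where open Iso i

-- The adjacency of `G` is an arbitrary function, so the computed verdict is about its triangular
-- copy; each of the three possible verdicts is carried back along the equality of adjacencies.
classify : ∀ {n} e Xs → Checked n e Xs → (G : Graph n) → edgeCount G ≡ e →
  NoCut G → EdgeInAtMostCycles 4 G → Any (λ X → Iso X G) Xs
classify {n} e Xs (checked ok) G count nc few
  with does-true (Small.Classified? H 4 Xs)
         (allTri-sound n e ok t (trans (sym (triCount-triangle (adj G))) (trans (sym (edgeCount-sum G)) count)))
  where
  t = triangle (adj G)
  H = triGraph t
... | inj₁ (_ , _ , over) =
  ⊥-elim (Small.Overloaded-absurd H (EdgeInAtMostCycles-embed (λ i → i) (λ _ _ e → e) (λ i j → sym (same i j)) few) over)
  where
  H = triGraph (triangle (adj G))
  same = triAdj-triangle (adj G) (adj-sym G) (adj-irr G)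
... | inj₂ (inj₁ (_ , _ , _ , cut)) =
  ⊥-elim (Small.CutOff-absurd (triGraph (triangle (adj G))) (NoCut-cong {G = G} (triAdj-triangle (adj G) (adj-sym G) (adj-irr G)) nc) cut)
... | inj₂ (inj₂ found) = Any.map (λ m → Iso-cong (triAdj-triangle (adj G) (adj-sym G) (adj-irr G)) (iso (Any.satisfied m))) found
  where
  iso : ∀ {X} → (∃ λ p → Small.Matches (triGraph (triangle (adj G))) X p) → Iso X (triGraph (triangle (adj G)))
  iso (p , m) = Small.Matches-Iso _ {p = p} m

data Special : AnyGraph → Set where
  K₂  : Special (K 2)
  K₃  : Special (K 3)
  θ₅  : Special (θ12 3)
  θ̃₅  : Special θ̃₁
  θ̃₅′ : Special θ̃₂
  θ₆  : Special (θ12 4)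

-- With f = 2 (n - 1) - e, the cases are f ≥ 2, f = 1 with n = 4, f = 0, and f = 1 with n ≠ 4.
data Block {n} (G : Graph n) (e : ℕ) : Set where
  sparse  : e + 4 ≤ n + n → Block G e
  diamond : n ≡ 4 → e ≡ 5 → Block G e
  full    : n ≡ 4 → e ≡ 6 → Iso (proj₂ (K 4)) G → Block G e
  special : ∀ {X} → Special X → proj₁ X ≡ n → e + 3 ≡ n + n → Iso (proj₂ X) G → Block G e

-- The relevant pairs satisfy `2n - 3 ≤ e ≤ n + 3`, that is `f ≤ 1` and cyclomatic number at most 4.
-- Apart from those below there are (4, 5), which becomes `diamond` without a search, and pairs with
-- more edges than `n` vertices can carry. The largest search, (6, 9), visits 5005 graphs.
check-2-1 : Checked 2 1 (proj₂ (K 2) ∷ [])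
check-2-1 = checked refl
check-3-3 : Checked 3 3 (proj₂ (K 3) ∷ [])
check-3-3 = checked refl
check-4-6 : Checked 4 6 (proj₂ (K 4) ∷ [])
check-4-6 = checked refl
check-5-7 : Checked 5 7 (proj₂ (θ12 3) ∷ proj₂ θ̃₁ ∷ proj₂ θ̃₂ ∷ [])
check-5-7 = checked refl
check-5-8 : Checked 5 8 []
check-5-8 = checked refl
check-6-9 : Checked 6 9 (proj₂ (θ12 4) ∷ [])
check-6-9 = checked refl

private
  too-many : ∀ k d → ¬ (k + d + 1 ≤ k)
  too-many k d p = m+1+n≰m k (subst (_≤ k) (trans (+-assoc k d 1) (cong (k +_) (+-comm d 1))) p)

  -- In this parametrization `f = 1 - d`. The bound on the cyclomatic number leaves finitely many
  -- pairs `n`, `d`.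
  dense : ∀ n (G : Graph n) d → 2 ≤ n → (n + n ∸ 3) + d + 1 ≤ n + 4 →
    (∀ Xs → Checked n ((n + n ∸ 3) + d) Xs → Any (λ X → Iso X G) Xs) → Block G ((n + n ∸ 3) + d)
  dense 1 G d (s≤s ()) b find
  dense 2 G 0 _ b find with find (proj₂ (K 2) ∷ []) check-2-1
  ... | here i = special K₂ refl refl i
  dense 3 G 0 _ b find with find (proj₂ (K 3) ∷ []) check-3-3
  ... | here i = special K₃ refl refl i
  dense 4 G 0 _ b find = diamond refl refl
  dense 4 G 1 _ b find with find (proj₂ (K 4) ∷ []) check-4-6
  ... | here i = full refl refl i
  dense 5 G 0 _ b find with find (proj₂ (θ12 3) ∷ proj₂ θ̃₁ ∷ proj₂ θ̃₂ ∷ []) check-5-7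
  ... | here i                 = special θ₅ refl refl i
  ... | there (here i)         = special θ̃₅ refl refl i
  ... | there (there (here i)) = special θ̃₅′ refl refl i
  dense 6 G 0 _ b find with find (proj₂ (θ12 4) ∷ []) check-6-9
  ... | here i = special θ₆ refl refl i
  -- From here on no graph qualifies. Nearly all these searches are empty because there are too many
  -- edges; only (5, 8) has candidates, and each has five cycles through some edge.
  dense 2 G 1 _ b find with () ← find [] (checked refl)
  dense 2 G 2 _ b find with () ← find [] (checked refl)
  dense 2 G 3 _ b find with () ← find [] (checked refl)
  dense 2 G 4 _ b find with () ← find [] (checked refl)
  dense 3 G 1 _ b find with () ← find [] (checked refl)
  dense 3 G 2 _ b find with () ← find [] (checked refl)
  dense 3 G 3 _ b find with () ← find [] (checked refl)
  dense 4 G 2 _ b find with () ← find [] (checked refl)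
  dense 5 G 1 _ b find with () ← find [] check-5-8
  dense 2 G (suc (suc (suc (suc (suc d))))) _ b find = ⊥-elim (too-many 6 d b)
  dense 3 G (suc (suc (suc (suc d)))) _ b find = ⊥-elim (too-many 7 d b)
  dense 4 G (suc (suc (suc d))) _ b find = ⊥-elim (too-many 8 d b)
  dense 5 G (suc (suc d)) _ b find = ⊥-elim (too-many 9 d b)
  dense 6 G (suc d) _ b find = ⊥-elim (too-many 10 d b)
  dense n@(suc (suc (suc (suc (suc (suc (suc m))))))) G d _ b find =
    ⊥-elim (<⇒≱ (n<1+n (n + 4)) (≤-trans (subst (suc (n + 4) ≤_) (shift m) (m≤m+n (suc (n + 4)) m))
                                   (≤-trans (+-monoˡ-≤ 1 (m≤m+n (n + n ∸ 3) d)) b)))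
    where
    -- With `n = 7 + m`, the term `n + n ∸ 3` reduces to `4 + m + (7 + m)`, already too large for
    -- the bound when `d = 0`.
    shift : ∀ m → suc (7 + m + 4) + m ≡ (4 + m + (7 + m)) + 1
    shift = solve-∀

block : ∀ {n} (G : Graph n) → 2 ≤ n → Connected G → NoCut G → EdgeInAtMostCycles 4 G → Block G (edgeCount G)
block {n} G 2≤n conn nc few with edgeCount G + 4 ≤? n + n
... | yes p = sparse p
... | no ¬p = subst (Block G) split (dense n G (edgeCount G ∸ (n + n ∸ 3)) 2≤n
    (subst (λ e → e + 1 ≤ n + 4) (sym split) (edgeCount-noCut G 2≤n conn nc few))
    (λ Xs ok → classify _ Xs ok G (sym split) nc few))
  where
  split : (n + n ∸ 3) + (edgeCount G ∸ (n + n ∸ 3)) ≡ edgeCount G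
  split = m+[n∸m]≡n (m≤n+o⇒m∸n≤o (n + n) 3 (≤-pred (subst (suc (n + n) ≤_) (+-comm (edgeCount G) 4) (≰⇒> ¬p))))

-- The windmill

SameCycle-sym : ∀ {n} (c d : List (Fin n)) → SameCycle c d → SameCycle d c
SameCycle-sym c d s a b = let p , q = s a b in q , p

SameCycle-trans : ∀ {n} (c d e : List (Fin n)) → SameCycle c d → SameCycle d e → SameCycle c e
SameCycle-trans c d e s t a b = proj₁ (t a b) ∘ proj₁ (s a b) , proj₂ (s a b) ∘ proj₂ (t a b)

SameCycle? : ∀ {n} (c d : List (Fin n)) → Dec (SameCycle c d)
SameCycle? c d = every? (λ a → every? (λ b →
  (ConsecIn? (close c) a b →-dec ConsecIn? (close d) a b) ×-dec (ConsecIn? (close d) a b →-dec ConsecIn? (close c) a b)))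

-- Two cycles with the same representative are the same by transitivity, so choosing representatives
-- is injective.
cycles-pigeonhole : ∀ {n} {cs} (rs : List (List (Fin n))) → All (λ c → Any (SameCycle c) rs) cs →
  AllPairs (λ c d → ¬ SameCycle c d) cs → length cs ≤ length rs
cycles-pigeonhole {cs = cs} rs reps diff = Fin.injective⇒≤ {f = class} (λ {i} {j} e →
  lookup-separates (λ {c} {d} → SameCycle-sym c d) diff i j
    (SameCycle-trans (lookup cs i) (lookup rs (class i)) (lookup cs j) (lookup-index (rep i))
      (SameCycle-sym (lookup cs j) (lookup rs (class i))
        (subst (λ k → SameCycle (lookup cs j) (lookup rs k)) (sym e) (lookup-index (rep j))))))
  where
  rep : ∀ i → Any (SameCycle (lookup cs i)) rs
  rep i = All.lookup reps (∈-lookup i)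
  class : Fin (length cs) → Fin (length rs)
  class i = index (rep i)

-- Cycles of K₄ and of the windmill

K₄ : Graph 4
K₄ = proj₂ (K 4)

K₄-adj : ∀ i j → i ≢ j → adj K₄ i j ≡ true
K₄-adj i j i≢j with i ≟ j
... | yes i≡j = ⊥-elim (i≢j i≡j)
... | no _    = refl

-- A decidable statement about one explicit vertex list, so that it can be evaluated for all lists
-- of three and of four vertices; longer cycles do not fit into K₄.
K₄-cycle : Fin 4 → Fin 4 → List (Fin 4) → Set
K₄-cycle a b c = adj K₄ a b ≡ true → Unique c → CycEdge c a b → Any (SameCycle c) (Small.cyclesThrough K₄ a b)

K₄-cycle? : ∀ a b c → Dec (K₄-cycle a b c)
K₄-cycle? a b c = (adj K₄ a b ≟ᵇ true) →-dec unique? _≟_ c →-dec ConsecIn? (close c) a b →-dec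
  Any.any? (SameCycle? c) (Small.cyclesThrough K₄ a b)

K₄-triangles : ∀ a b x y z → K₄-cycle a b (x ∷ y ∷ z ∷ [])
K₄-triangles = does-true (every? λ a → every? λ b → every? λ x → every? λ y → every? λ z →
  K₄-cycle? a b (x ∷ y ∷ z ∷ [])) refl

K₄-squares : ∀ a b x y z w → K₄-cycle a b (x ∷ y ∷ z ∷ w ∷ [])
K₄-squares = does-true (every? λ a → every? λ b → every? λ x → every? λ y → every? λ z → every? λ w →
  K₄-cycle? a b (x ∷ y ∷ z ∷ w ∷ [])) refl

-- Two triangles and two four-cycles pass through each edge; this is where the 4 in 4-cactus is
-- attained.
K₄-four : ∀ a b → adj K₄ a b ≡ true → length (Small.cyclesThrough K₄ a b) ≤ 4
K₄-four = does-true (every? λ a → every? λ b →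
  (adj K₄ a b ≟ᵇ true) →-dec (length (Small.cyclesThrough K₄ a b) ≤? 4)) refl

K₄-cactus : EdgeInAtMostCycles 4 K₄
K₄-cactus a b e cs cyc thr diff =
  ≤-trans (cycles-pigeonhole _ (All.map (λ {c} (p , q) → rep c p q) (All.zip (cyc , thr))) diff) (K₄-four a b e)
  where
  rep : ∀ c → IsCycle K₄ c → CycEdge c a b → Any (SameCycle c) (Small.cyclesThrough K₄ a b)
  rep (x ∷ [])                 (s≤s () , _)         ab
  rep (x ∷ y ∷ [])             (s≤s (s≤s ()) , _)   ab
  rep (x ∷ y ∷ z ∷ [])         (_ , u , _)          ab = K₄-triangles a b x y z e u ab
  rep (x ∷ y ∷ z ∷ w ∷ [])     (_ , u , _)          ab = K₄-squares a b x y z w e u ab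
  rep (x ∷ y ∷ z ∷ w ∷ v ∷ c)  (_ , u , _)          ab with Unique-length u
  ... | s≤s (s≤s (s≤s (s≤s ())))

-- The windmill: hub 0, and the other vertices 1, 2, 3, … grouped in threes.
sameBlade : ℕ → ℕ → Bool
sameBlade (suc m) (suc m') = ⌊ Nat._≟_ (m / 3) (m' / 3) ⌋
sameBlade _       _        = true

Windmill : ∀ n → Graph n
Windmill n = mkGraphℕ sameBlade

module _ {n : ℕ} where

  Hub : Fin n → Set
  Hub x = toℕ x ≡ 0

  Hub? : Decidable Hub
  Hub? x = Nat._≟_ (toℕ x) 0

  -- At the hub truncated subtraction produces a meaningless 0, so statements about blades treat the
  -- hub separately.
  blade : Fin n → ℕ
  blade x = (toℕ x ∸ 1) / 3

  Near : Fin n → Fin n → Set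
  Near x y = Hub x ⊎ Hub y ⊎ (blade x ≡ blade y)

  private
    near-true : ∀ m m' → (m ≡ 0) ⊎ (m' ≡ 0) ⊎ ((m ∸ 1) / 3 ≡ (m' ∸ 1) / 3) → sameBlade m m' ≡ true
    near-true zero    m'       _                = refl
    near-true (suc m) zero     _                = refl
    near-true (suc m) (suc m') (inj₂ (inj₂ e)) with Nat._≟_ (m / 3) (m' / 3)
    ... | yes _ = refl
    ... | no q  = ⊥-elim (q e)

    true-near : ∀ m m' → sameBlade m m' ∨ sameBlade m' m ≡ true → (m ≡ 0) ⊎ (m' ≡ 0) ⊎ ((m ∸ 1) / 3 ≡ (m' ∸ 1) / 3)
    true-near zero    m'       _ = inj₁ refl
    true-near (suc m) zero     _ = inj₂ (inj₁ refl)
    true-near (suc m) (suc m') e with Nat._≟_ (m / 3) (m' / 3) | Nat._≟_ (m' / 3) (m / 3)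
    ... | yes p | _     = inj₂ (inj₂ p)
    ... | no _  | yes p = inj₂ (inj₂ (sym p))
    true-near (suc m) (suc m') () | no _ | no _

  windmill-adj : ∀ {x y} → x ≢ y → Near x y → adj (Windmill n) x y ≡ true
  windmill-adj {x} {y} x≢y near with x ≟ y
  ... | yes x≡y = ⊥-elim (x≢y x≡y)
  ... | no _    = cong (_∨ sameBlade (toℕ y) (toℕ x)) (near-true (toℕ x) (toℕ y) near)

  windmill-near : ∀ {x y} → adj (Windmill n) x y ≡ true → (x ≢ y) × Near x y
  windmill-near {x} {y} e with x ≟ y
  ... | no x≢y = x≢y , true-near (toℕ x) (toℕ y) e

  private
    Linked-prefix : ∀ {G : Graph n} xs {ys} → Linked G (xs ++ ys) → Linked G xs
    Linked-prefix []           l       = tt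
    Linked-prefix (x ∷ [])     l       = tt
    Linked-prefix (x ∷ y ∷ xs) (e , l) = e , Linked-prefix (y ∷ xs) l

    Linked-suffix : ∀ {G : Graph n} xs {ys} → Linked G (xs ++ ys) → Linked G ys
    Linked-suffix []                 l       = l
    Linked-suffix (x ∷ []) {[]}      l       = tt
    Linked-suffix (x ∷ []) {_ ∷ _}   (_ , l) = l
    Linked-suffix (x ∷ y ∷ xs)       (_ , l) = Linked-suffix (y ∷ xs) l

    sameBlade-linked : ∀ {xs} → Linked (Windmill n) xs → All (¬_ ∘ Hub) xs → ∀ {x y} → x ∈ xs → y ∈ xs → blade x ≡ blade y
    sameBlade-linked {x ∷ xs} l hs p q = trans (toHead l hs p) (sym (toHead l hs q))
      where
      toHead : ∀ {x xs y} → Linked (Windmill n) (x ∷ xs) → All (¬_ ∘ Hub) (x ∷ xs) → y ∈ x ∷ xs → blade y ≡ blade x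
      toHead l hs (here refl) = refl
      toHead {xs = z ∷ zs} (e , l) (h ∷ hs@(h' ∷ _)) (there p) with windmill-near e
      ... | _ , inj₁ hub             = ⊥-elim (h hub)
      ... | _ , inj₂ (inj₁ hub)      = ⊥-elim (h' hub)
      ... | _ , inj₂ (inj₂ same)     = trans (toHead l hs p) (sym same)

  -- Deleting the hub from a cycle leaves a path, which cannot leave its blade.
  cycle-blade : ∀ {c} → IsCycle (Windmill n) c → ∀ {x y} → x ∈ c → y ∈ c → ¬ Hub x → ¬ Hub y → blade x ≡ blade y
  cycle-blade {c} (_ , u , l) x∈ y∈ ¬x ¬y with Any.any? Hub? c
  ... | no none = sameBlade-linked (Linked-prefix c l) (AllP.¬Any⇒All¬ c none) x∈ y∈
  ... | yes some with find some
  ...   | h , h∈ , hub with ∈-∃++ h∈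
  ...     | L , M , refl = trans (toBase x∈ ¬x) (sym (toBase y∈ ¬y))
    where
    parts : Unique L × Unique (h ∷ M) × (∀ {x} → x ∈ L → x ∈ h ∷ M → ⊥)
    parts = Unique-++⁻ L u
    ¬hubM : All (¬_ ∘ Hub) M
    ¬hubM with proj₁ (proj₂ parts)
    ... | p ∷ _ = All.map (λ h≢ e → h≢ (toℕ-injective (trans hub (sym e)))) p
    ¬hubL : All (¬_ ∘ Hub) L
    ¬hubL = All.tabulate (λ z∈ e → proj₂ (proj₂ parts) z∈ (here (toℕ-injective (trans e (sym hub)))))
    -- A reference vertex: the head of `L`, or of `M` if `L` is empty. For `L` with head `a`, both
    -- `L` and, across the closing edge, `M` followed by `a` are hub-free walks, and they share `a`.
    base : Fin n → List (Fin n) → Fin n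
    base d []      = d
    base d (z ∷ _) = z
    toBase : ∀ {z} → z ∈ L ++ h ∷ M → ¬ Hub z → blade z ≡ blade (base (base h M) L)
    toBase = go L l ¬hubL
      where
      go : ∀ L → Linked (Windmill n) (close (L ++ h ∷ M)) → All (¬_ ∘ Hub) L →
        ∀ {z} → z ∈ L ++ h ∷ M → ¬ Hub z → blade z ≡ blade (base (base h M) L)
      go [] l _ (here refl) ¬z = ⊥-elim (¬z hub)
      go [] l _ (there z∈) ¬z = sameBlade-linked (Linked-prefix M (Linked-suffix [ h ] l)) ¬hubM z∈ (head∈ z∈)
        where
        head∈ : ∀ {z M} → z ∈ M → base h M ∈ M
        head∈ (here _)  = here refl
        head∈ (there _) = here refl
      go (a ∷ L) l ¬L z∈ ¬z with ∈-++⁻ (a ∷ L) z∈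
      ... | inj₁ p = sameBlade-linked (Linked-prefix (a ∷ L) (Linked-prefix (a ∷ L ++ h ∷ M) l)) ¬L p (here refl)
      ... | inj₂ (here refl) = ⊥-elim (¬z hub)
      ... | inj₂ (there p) = sameBlade-linked
          (Linked-suffix [ h ] (Linked-suffix (a ∷ L) (subst (Linked (Windmill n)) (++-assoc (a ∷ L) (h ∷ M) [ a ]) l)))
          (AllP.++⁺ ¬hubM (All.head ¬L ∷ [])) (∈-++⁺ˡ p) (∈-++⁺ʳ M (here refl))

  private
    -- Folds all blades onto one K₄ with the hub at 0. Within a blade the remainder modulo 3
    -- identifies the vertex.
    colourℕ : ℕ → Fin 4
    colourℕ zero    = zero
    colourℕ (suc m) = suc (m mod 3)

    colour : Fin n → Fin 4
    colour x = colourℕ (toℕ x)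

    InBlade : ℕ → Fin n → Set
    InBlade q x = Hub x ⊎ (blade x ≡ q)

    colour-injective : ∀ {q x y} → InBlade q x → InBlade q y → colour x ≡ colour y → x ≡ y
    colour-injective {q} {x} {y} px py e = toℕ-injective (go (toℕ x) (toℕ y) px py e)
      where
      go : ∀ m m' → (m ≡ 0) ⊎ ((m ∸ 1) / 3 ≡ q) → (m' ≡ 0) ⊎ ((m' ∸ 1) / 3 ≡ q) → colourℕ m ≡ colourℕ m' → m ≡ m'
      go zero    zero     _        _        _ = refl
      go (suc m) (suc m') (inj₂ p) (inj₂ p') e = cong suc (begin
        m                     ≡⟨ m≡m%n+[m/n]*n m 3 ⟩
        m % 3 + (m / 3) * 3   ≡⟨ cong₂ (λ r d → r + d * 3) rem (trans p (sym p')) ⟩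
        m' % 3 + (m' / 3) * 3 ≡⟨ m≡m%n+[m/n]*n m' 3 ⟨
        m' ∎)
        where
        open ≡-Reasoning
        rem : m % 3 ≡ m' % 3
        rem = trans (sym (toℕ-fromℕ< (m%n<n m 3))) (trans (cong toℕ (Fin.suc-injective e)) (toℕ-fromℕ< (m%n<n m' 3)))

  windmill-few : EdgeInAtMostCycles 4 (Windmill n)
  windmill-few a b e cs cyc thr diff =
    cycles-transfer colour colour-injective K₄-cactus
      (λ {x} {y} px py xy → K₄-adj (colour x) (colour y) (λ c → proj₁ (windmill-near xy) (colour-injective px py c)))
      (proj₁ home) (proj₁ (proj₂ home)) e cs
      (All.map (λ {c} (p , q) → proj₂ (proj₂ home) c p q) (All.zip (cyc , thr))) cyc thr diff
    where
    -- The blade of the edge `ab`, read off at an end that is not the hub.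
    q : ℕ
    q with Hub? a
    ... | yes _ = blade b
    ... | no _  = blade a
    confined : ∀ {x} → ¬ Hub x → ∀ c → IsCycle (Windmill n) c → x ∈ c → All (InBlade (blade x)) c
    confined {x} ¬x c isC x∈ = All.tabulate inBlade
      where
      inBlade : ∀ {y} → y ∈ c → InBlade (blade x) y
      inBlade {y} y∈ with Hub? y
      ... | yes hy = inj₁ hy
      ... | no ¬y  = inj₂ (cycle-blade isC y∈ x∈ ¬y ¬x)
    home : InBlade q a × InBlade q b × (∀ c → IsCycle (Windmill n) c → CycEdge c a b → All (InBlade q) c)
    home with Hub? a
    ... | yes ha = inj₁ ha , inj₂ refl ,
      λ c isC ab → confined (λ hb → proj₁ (windmill-near e) (toℕ-injective (trans ha (sym hb)))) c isC (proj₂ (CycEdge-∈ c ab))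
    ... | no ¬a = inj₂ refl , near-a (proj₂ (windmill-near e)) , λ c isC ab → confined ¬a c isC (proj₁ (CycEdge-∈ c ab))
      where
      near-a : Near a b → InBlade (blade a) b
      near-a (inj₁ ha)       = ⊥-elim (¬a ha)
      near-a (inj₂ (inj₁ h)) = inj₁ h
      near-a (inj₂ (inj₂ s)) = inj₂ (sym s)

windmill-connected : ∀ {n} → 1 ≤ n → Connected (Windmill n)
windmill-connected {suc n} _ u v = Reach-trans (toHub u) (Reach-sym (toHub v))
  where
  toHub : ∀ u → Reach (Windmill (suc n)) u zero
  toHub zero    = here
  toHub (suc u) = step (windmill-adj {suc n} {suc u} {zero} (λ ()) (inj₂ (inj₁ refl))) here

-- Edge count of the windmill

sum-≥-length : ∀ {n} {h : Fin n → ℕ} {xs} → Unique xs → All (λ x → 1 ≤ h x) xs → length xs ≤ sum h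
sum-≥-length {n} {h} {xs} u ps = begin
  length xs                                   ≡⟨ sum-one (length xs) ⟨
  (∑[ i < length xs ] 1)                      ≤⟨ sum-mono (λ i → All.lookup ps (∈-lookup i)) ⟩
  (∑[ i < length xs ] h (lookup xs i))        ≡⟨ sum-reindex (lookup xs) h ⟨
  (∑[ x < n ] (fibre (lookup xs) x * h x))    ≤⟨ sum-mono (λ x → ≤-trans (*-monoˡ-≤ (h x) (fibre-≤ x)) (≤-reflexive (*-identityˡ (h x)))) ⟩
  sum h ∎
  where
  open ≤-Reasoning
  fibre-≤ : ∀ x → fibre (lookup xs) x ≤ 1
  fibre-≤ x with any? (λ i → lookup xs i ≟ x)
  ... | yes (i , refl) = ≤-reflexive (fibre-∈ (lookup-separates sym u) i)
  ... | no none        = ≤-trans (≤-reflexive (fibre-∉ {f = lookup xs} (λ i e → none (i , e)))) z≤n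

-- The neighbours with smaller number: the hub and the `m % 3` earlier vertices of the same blade.
backDegree : ℕ → ℕ
backDegree zero    = 0
backDegree (suc m) = suc (m % 3)

windmill-back : ∀ {n} (j : Fin n) → backDegree (toℕ j) ≤ ∑[ i < n ] ⟦ adj (Windmill n) i j ∧ (toℕ i <ᵇ toℕ j) ⟧
windmill-back {suc n} j = go (toℕ j) refl
  where
  edge : Fin (suc n) → ℕ
  edge i = ⟦ adj (Windmill (suc n)) i j ∧ (toℕ i <ᵇ toℕ j) ⟧
  edge-1 : ∀ i → toℕ i < toℕ j → Near i j → 1 ≤ edge i
  edge-1 i i<j near rewrite windmill-adj {suc n} {i} {j} (λ i≡j → <⇒≢ i<j (cong toℕ i≡j)) near | <ᵇ-true i<j = s≤s z≤n
  go : ∀ m → toℕ j ≡ m → backDegree m ≤ sum edge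
  go zero    eq = z≤n
  go (suc m) eq = subst (_≤ sum edge) (cong suc (length-tabulate inner))
    (sum-≥-length {h = edge} {xs = zero ∷ tabulate inner} (AllP.tabulate⁺ zero≢ ∷ Unique.tabulate⁺ inner-injective)
      (edge-1 zero (subst (0 <_) (sym eq) (s≤s z≤n)) (inj₁ refl) ∷
       AllP.tabulate⁺ (λ t → edge-1 (inner t) (inner< t) (inj₂ (inj₂ (inner-blade t))))))
    where
    q : ℕ
    q = m / 3
    inner<m : ∀ (t : Fin (m % 3)) → toℕ t + q * 3 < m
    inner<m t = subst (toℕ t + q * 3 <_) (sym (m≡m%n+[m/n]*n m 3)) (+-monoˡ-< (q * 3) (toℕ<n t))
    m<n : m < n
    m<n = ≤-pred (subst (_< suc n) eq (toℕ<n j))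
    -- Vertex `m + 1` is preceded in its blade `q` by the vertices `1 + t + 3q` with `t < m % 3`.
    inner : Fin (m % 3) → Fin (suc n)
    inner t = suc (fromℕ< (<-trans (inner<m t) m<n))
    toℕ-inner : ∀ t → toℕ (inner t) ≡ suc (toℕ t + q * 3)
    toℕ-inner t = cong suc (toℕ-fromℕ< _)
    zero≢ : ∀ t → zero ≢ inner t
    zero≢ t ()
    inner-injective : ∀ {t t'} → inner t ≡ inner t' → t ≡ t'
    inner-injective {t} {t'} e = toℕ-injective (+-cancelʳ-≡ (q * 3) (toℕ t) (toℕ t')
      (suc-injective (trans (sym (toℕ-inner t)) (trans (cong toℕ e) (toℕ-inner t')))))
    inner< : ∀ t → toℕ (inner t) < toℕ j
    inner< t = subst (toℕ (inner t) <_) (sym eq) (subst (_< suc m) (sym (toℕ-inner t)) (s≤s (inner<m t)))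
    inner-blade : ∀ t → blade (inner t) ≡ blade j
    inner-blade t = begin
      blade (inner t)       ≡⟨ cong (λ z → (z ∸ 1) / 3) (toℕ-inner t) ⟩
      (toℕ t + q * 3) / 3   ≡⟨ +-distrib-/-∣ʳ (toℕ t) (n∣m*n q) ⟩
      toℕ t / 3 + q * 3 / 3 ≡⟨ cong₂ _+_ (m<n⇒m/n≡0 (<-trans (toℕ<n t) (m%n<n m 3))) (m*n/n≡m q 3) ⟩
      q                     ≡⟨ cong (λ z → (z ∸ 1) / 3) eq ⟨
      blade j ∎
      where open ≡-Reasoning

sum-toℕ-last : ∀ n (g : ℕ → ℕ) → ∑[ j < suc n ] g (toℕ j) ≡ (∑[ j < n ] g (toℕ j)) + g n
sum-toℕ-last zero    g = +-comm (g 0) 0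
sum-toℕ-last (suc n) g = trans (cong (g 0 +_) (sum-toℕ-last n (g ∘ suc))) (sym (+-assoc (g 0) _ (g (suc n))))

backDegrees : ℕ → ℕ
backDegrees n = ∑[ j < n ] backDegree (toℕ j)

backDegrees-suc : ∀ r k → r < 3 → backDegrees (2 + r + k * 3) ≡ backDegrees (1 + r + k * 3) + suc r
backDegrees-suc r k r<3 = trans (sum-toℕ-last (1 + r + k * 3) backDegree)
  (cong (λ z → backDegrees (1 + r + k * 3) + suc z) (trans ([m+kn]%n≡m%n r k 3) (m<n⇒m%n≡m r<3)))

-- A full blade contributes `1 + 2 + 3 = 6`, a partial one 1 or `1 + 2`. In terms of `f` the three
-- residues give 0, 1 and 1.
backDegrees-1 : ∀ k → backDegrees (1 + k * 3) ≡ k * 6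
backDegrees-2 : ∀ k → backDegrees (2 + k * 3) ≡ k * 6 + 1
backDegrees-3 : ∀ k → backDegrees (3 + k * 3) ≡ k * 6 + 3
backDegrees-1 zero    = refl
backDegrees-1 (suc k) = trans (backDegrees-suc 2 k (≤ᵇ⇒≤ 3 3 tt)) (trans (cong (_+ 3) (backDegrees-3 k))
                    (trans (+-assoc (k * 6) 3 3) (+-comm (k * 6) 6)))
backDegrees-2 k = trans (backDegrees-suc 0 k (≤ᵇ⇒≤ 1 3 tt)) (cong (_+ 1) (backDegrees-1 k))
backDegrees-3 k = trans (backDegrees-suc 1 k (≤ᵇ⇒≤ 2 3 tt)) (trans (cong (_+ 2) (backDegrees-2 k)) (+-assoc (k * 6) 1 2))

windmill-backDegrees : ∀ n → backDegrees n ≤ edgeCount (Windmill n)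
windmill-backDegrees n = ≤-trans (sum-mono {n} (windmill-back {n})) (≤-reflexive (trans
  (sym (∑-comm {n} {n} (λ i j → ⟦ adj (Windmill n) i j ∧ (toℕ i <ᵇ toℕ j) ⟧))) (sym (edgeCount-sum (Windmill n)))))

extremal-≥ : ∀ {n} {G : Graph n} → 1 ≤ n → Extremal 4 G → backDegrees n ≤ edgeCount G
extremal-≥ {n} 1≤n (_ , best) = ≤-trans (windmill-backDegrees n) (best (Windmill n) (windmill-connected 1≤n , windmill-few))

-- Gluing blocks

-- A leaf block is only isomorphic to K₄ or to a special graph, whereas `CoalOf` lists those graphs
-- themselves.
CoalAt-Iso : ∀ {a b c N} {G : Graph a} {v} {H : Graph b} {w} {L : Graph N} {X : Graph c} →
  CoalAt G v H w L → (i : Iso X H) → CoalAt G v X (Iso.from i w) L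
CoalAt-Iso {w = w} C i = record
  { f = f ; g = g ∘ to ; f-inj = f-inj
  ; g-inj = λ j j' e → trans (sym (from-to j)) (trans (cong from (g-inj _ _ e)) (from-to j'))
  ; glue = trans glue (cong g (sym (to-from w)))
  ; meet = λ k j e → proj₁ (meet k (to j) e) , trans (sym (from-to j)) (cong from (proj₂ (meet k (to j) e)))
  ; cover = λ x → map₂ (λ (j , e) → from j , trans (cong g (to-from j)) e) (cover x)
  ; adj-f = adj-f
  ; adj-g = λ j j' → trans (adj-g (to j) (to j')) (adj-pres j j')
  ; adj-fg = λ k j e → map₂ (λ p → trans (sym (from-to j)) (cong from p)) (adj-fg k (to j) e) }
  where
  open CoalAt C
  open Iso i

-- With f = 2 (n - 1) - e, the cases are f ≥ 2, f = 1 with n ≡ 1 (mod 3), f = 0, and f = 1 otherwise.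
data Outcome {n} (G : Graph n) (e : ℕ) : Set where
  sparse  : e + 4 ≤ n + n → Outcome G e
  almost  : ∀ k → n ≡ 1 + k * 3 → e + 3 ≡ n + n → Outcome G e
  -- `CoalOf` begins with one graph, so K₁ is not a coalescence of zero copies and has to be
  -- excepted.
  tight   : ∀ k → n ≡ 1 + k * 3 → e + 2 ≡ n + n → (n ≢ 1 → CoalOf (copies k (K 4)) G) → Outcome G e
  special : ∀ k {X Ks} → Special X → n ≡ proj₁ X + k * 3 → e + 3 ≡ n + n →
            Ks ↭ copies k (K 4) ++ [ X ] → CoalOf Ks G → Outcome G e

Block⇒Outcome : ∀ {n} {G : Graph n} {e} → Block G e → Outcome G e
Block⇒Outcome (sparse p)              = sparse p
Block⇒Outcome (diamond refl refl)     = almost 1 refl refl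
Block⇒Outcome (full refl refl i)      = tight 1 refl refl (λ _ → one i)
Block⇒Outcome (special {X} S refl e i) = special 0 S (sym (+-identityʳ (proj₁ X))) e ↭-refl (one i)

private
  -- This is `f ≥ 0`; hence one part with `f ≥ 2` makes the whole coalescence sparse.
  excess : ∀ {n} {G : Graph n} {e} → Outcome G e → e + 2 ≤ n + n
  excess {e = e} (sparse p)          = ≤-trans (+-monoʳ-≤ e (≤ᵇ⇒≤ 2 4 tt)) p
  excess {e = e} (almost _ _ p)      = ≤-trans (+-monoʳ-≤ e (≤ᵇ⇒≤ 2 3 tt)) (≤-reflexive p)
  excess         (tight _ _ p _)     = ≤-reflexive p
  excess {e = e} (special _ _ _ p _ _) = ≤-trans (+-monoʳ-≤ e (≤ᵇ⇒≤ 2 3 tt)) (≤-reflexive p)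

module Glue {a b n} {A : Graph a} {v : Fin a} {B : Graph b} {w : Fin b} {G : Graph n}
            (C : CoalAt A v B w G) (2≤a : 2 ≤ a) where

  private
    double : suc n + suc n ≡ (a + a) + (b + b)
    double = trans (cong₂ _+_ (coal-order C) (coal-order C)) (interchange a b a b)

    -- Here `x` and `y` are lower bounds for `f + 2` of the parts, so `x + y = 6` says that the two
    -- values of `f` add up to at least 2. The shared vertex accounts for the shift by 2.
    join-≤ : ∀ {e e'} x y → x + y ≡ 6 → e + x ≤ a + a → e' + y ≤ b + b → (e + e') + 4 ≤ n + n
    join-≤ {e} {e'} x y x+y p q = ≤-pred (≤-pred (begin
      2 + ((e + e') + 4)    ≡⟨ shift (e + e') ⟩
      (e + e') + 6          ≡⟨ cong ((e + e') +_) x+y ⟨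
      (e + e') + (x + y)    ≡⟨ interchange e e' x y ⟩
      (e + x) + (e' + y)    ≤⟨ +-mono-≤ p q ⟩
      (a + a) + (b + b)     ≡⟨ double ⟨
      suc (n + suc n)       ≡⟨ cong suc (+-suc n n) ⟩
      2 + (n + n)           ∎))
      where
      open ≤-Reasoning
      shift : ∀ z → 2 + (z + 4) ≡ z + 6
      shift = solve-∀

    join-≡ : ∀ {e e'} x y z → x + y ≡ 2 + z → e + x ≡ a + a → e' + y ≡ b + b → (e + e') + z ≡ n + n
    join-≡ {e} {e'} x y z x+y p q = suc-injective (suc-injective (begin
      2 + ((e + e') + z)    ≡⟨ shift (e + e') z ⟩
      (e + e') + (2 + z)    ≡⟨ cong ((e + e') +_) x+y ⟨
      (e + e') + (x + y)    ≡⟨ interchange e e' x y ⟩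
      (e + x) + (e' + y)    ≡⟨ cong₂ _+_ p q ⟩
      (a + a) + (b + b)     ≡⟨ double ⟨
      suc (n + suc n)       ≡⟨ cong suc (+-suc n n) ⟩
      2 + (n + n)           ∎))
      where
      open ≡-Reasoning
      shift : ∀ u z → 2 + (u + z) ≡ u + (2 + z)
      shift = solve-∀

    -- For a block of order 4, `t` is 3 and the right-hand side computes to `s + suc k * 3`.
    order : ∀ s {t} k → a ≡ s + k * 3 → b ≡ suc t → n ≡ s + (t + k * 3)
    order s {t} k refl refl = suc-injective (trans (coal-order C) (shift s t (k * 3)))
      where
      shift : ∀ s t u → (s + u) + suc t ≡ suc (s + (t + u))
      shift = solve-∀

    a≢1 : a ≢ 1
    a≢1 a≡1 = <⇒≱ 2≤a (≤-reflexive a≡1)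

  -- A case distinction on how the values of `f` add up. A diamond moves `n` by 3 just as K₄ does,
  -- so for `almost` the residue is all that must be remembered. The special block may be glued at
  -- any stage, hence the permutation.
  glue-block : ∀ {e e'} → Outcome A e → Block B e' → Outcome G (e + e')
  glue-block o (sparse p) = sparse (join-≤ 2 4 refl (excess o) p)
  glue-block (sparse p) bl = sparse (join-≤ 4 2 refl p (excess (Block⇒Outcome bl)))
  glue-block (tight k na p co) (full nb refl i) =
    tight (suc k) (order 1 k na nb) (join-≡ 2 2 2 refl p (cong (λ z → z + z) (sym nb)))
      (λ _ → step v (Iso.from i w) (co a≢1) (CoalAt-Iso C i))
  glue-block (tight k na p co) (diamond nb refl) =
    almost (suc k) (order 1 k na nb) (join-≡ 2 3 3 refl p (cong (λ z → z + z) (sym nb)))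
  glue-block (tight k na p co) (special {X} S refl q i) =
    special k S (suc-injective (trans (coal-order C) (trans (cong (_+ proj₁ X) na) (cong suc (+-comm (k * 3) (proj₁ X))))))
      (join-≡ 2 3 3 refl p q) (∷↭∷ʳ X (copies k (K 4))) (step v (Iso.from i w) (co a≢1) (CoalAt-Iso C i))
  glue-block (almost k na p) (full nb refl i) =
    almost (suc k) (order 1 k na nb) (join-≡ 3 2 3 refl p (cong (λ z → z + z) (sym nb)))
  glue-block (special k {X} S na p perm co) (full nb refl i) =
    special (suc k) S (order (proj₁ X) k na nb) (join-≡ 3 2 3 refl p (cong (λ z → z + z) (sym nb)))
      (prep _ perm) (step v (Iso.from i w) co (CoalAt-Iso C i))
  glue-block (almost k na p) (diamond nb refl) =
    sparse (join-≤ 3 3 refl (≤-reflexive p) (≤-reflexive (cong (λ z → z + z) (sym nb))))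
  glue-block (almost k na p) (special _ _ q _) = sparse (join-≤ 3 3 refl (≤-reflexive p) (≤-reflexive q))
  glue-block (special _ _ _ p _ _) (diamond nb refl) =
    sparse (join-≤ 3 3 refl (≤-reflexive p) (≤-reflexive (cong (λ z → z + z) (sym nb))))
  glue-block (special _ _ _ p _ _) (special _ _ q _) = sparse (join-≤ 3 3 refl (≤-reflexive p) (≤-reflexive q))

edgeCount-1 : (G : Graph 1) → edgeCount G ≡ 0
edgeCount-1 G rewrite adj-irr G zero = refl

module _ {n} (G : Graph n) (conn : Connected G) (few : EdgeInAtMostCycles 4 G) where

  -- The leaf block is classified by `block` and the rest by recursion, matching the way `CoalOf`
  -- attaches one graph to what is already built.
  outcome-step : 2 ≤ n →
    (∀ {m} (H : Graph m) → m < n → 1 ≤ m → Connected H → EdgeInAtMostCycles 4 H → Outcome H (edgeCount H)) →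
    Outcome G (edgeCount G)
  outcome-step 2≤n rec with noCut-or-separation G
  ... | inj₁ nc = Block⇒Outcome (block G 2≤n conn nc few)
  ... | inj₂ S₀ = subst (Outcome G) (sym (coal-edgeCount C))
      (Glue.glue-block C 2≤a
        (rec Q.graph a<n (≤-trans (s≤s z≤n) 2≤a) (Sides.connectedP (Separation-swap S) conn)
          (EdgeInAtMostCycles-embed Q.emb Q.emb-injective (λ _ _ → refl) few))
        (block P.graph 2≤b (Sides.connectedP S conn) (proj₂ leaf)
          (EdgeInAtMostCycles-embed P.emb P.emb-injective (λ _ _ → refl) few)))
    where
    leaf : Σ (Separation G) λ S → NoCut (Induced.graph G (Separation.P? S))
    leaf = leafBlock _ S₀ (n<1+n _)
    S : Separation G
    S = proj₁ leaf
    module P = Sides.InP S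
    module Q = Sides.InQ S
    C : CoalAt Q.graph (proj₁ (Sides.c∈Q S)) P.graph (proj₁ (Sides.c∈P S)) G
    C = Sides.coalescence S
    2≤b : 2 ≤ P.size
    2≤b = Sides.sizeP S
    2≤a : 2 ≤ Q.size
    2≤a = Sides.sizeP (Separation-swap S)
    a<n : Q.size < n
    a<n = ≤-pred (subst (2 + Q.size ≤_) (trans (+-comm P.size Q.size) (sym (coal-order C))) (+-monoˡ-≤ Q.size 2≤b))

outcome : ∀ k {n} (G : Graph n) → n < k → 1 ≤ n → Connected G → EdgeInAtMostCycles 4 G → Outcome G (edgeCount G)
outcome (suc k) {1}           G _         _ _    _   =
  tight 0 refl (cong (_+ 2) (edgeCount-1 G)) (λ 1≢1 → ⊥-elim (1≢1 refl))
outcome (suc k) {suc (suc n)} G (s≤s n≤k) _ conn few =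
  outcome-step G conn few (s≤s (s≤s z≤n)) (λ H m<n → outcome k H (≤-trans m<n n≤k))

-- Residues modulo 3 and the conclusion

private
  n≡[n∸1]+1 : ∀ {n} → 1 ≤ n → n ≡ suc (n ∸ 1)
  n≡[n∸1]+1 (s≤s _) = refl

  backDegrees-≥ : ∀ {n} → 1 ≤ n → n + n ≤ backDegrees n + 3
  backDegrees-≥ {n} 1≤n = go ((n ∸ 1) % 3) ((n ∸ 1) / 3) (m%n<n (n ∸ 1) 3)
      (trans (n≡[n∸1]+1 1≤n) (cong suc (m≡m%n+[m/n]*n (n ∸ 1) 3)))
    where
    1+ : ∀ k → suc ((1 + k * 3) + (1 + k * 3)) ≡ k * 6 + 3
    1+ = solve-∀
    2+ : ∀ k → (2 + k * 3) + (2 + k * 3) ≡ k * 6 + 1 + 3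
    2+ = solve-∀
    3+ : ∀ k → (3 + k * 3) + (3 + k * 3) ≡ k * 6 + 3 + 3
    3+ = solve-∀
    go : ∀ r k → r < 3 → n ≡ 1 + (r + k * 3) → n + n ≤ backDegrees n + 3
    go 0 k _ refl = ≤-trans (n≤1+n _) (≤-reflexive (trans (1+ k) (cong (_+ 3) (sym (backDegrees-1 k)))))
    go 1 k _ refl = ≤-reflexive (trans (2+ k) (cong (_+ 3) (sym (backDegrees-2 k))))
    go 2 k _ refl = ≤-reflexive (trans (3+ k) (cong (_+ 3) (sym (backDegrees-3 k))))
    go (suc (suc (suc _))) k (s≤s (s≤s (s≤s ()))) eq

  backDegrees-tight : ∀ {n} k → n ≡ 1 + k * 3 → n + n ≡ backDegrees n + 2
  backDegrees-tight k refl = trans (eq k) (cong (_+ 2) (sym (backDegrees-1 k)))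
    where
    eq : ∀ k → (1 + k * 3) + (1 + k * 3) ≡ k * 6 + 2
    eq = solve-∀

  residue : ∀ {n} s k → n ≡ s + k * 3 → n % 3 ≡ s % 3
  residue s k eq = trans (cong (_% 3) eq) ([m+kn]%n≡m%n s k 3)

  quotient : ∀ {n} s k → n ≡ s + k * 3 → (n ∸ s) / 3 ≡ k
  quotient s k refl = trans (cong (_/ 3) (m+n∸m≡n s (k * 3))) (m*n/n≡m k 3)

  -- For numerals `s` and `r` the implicit argument is found by evaluating `s % 3`, so a wrong
  -- residue class is dismissed without further proof.
  impossible : ∀ {n} s k {r} {A : Set} {_ : False (Nat._≟_ (s % 3) r)} → n ≡ s + k * 3 → n % 3 ≡ r → A
  impossible s k {_} {_} {p} eq nr = ⊥-elim (toWitnessFalse p (trans (sym (residue s k eq)) nr))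

  at-least : ∀ {n} s k → n ≡ s + k * 3 → s ≤ n
  at-least s k refl = m≤m+n s (k * 3)

  obtained : ∀ {n k X Ks} {G : Graph n} → Ks ↭ copies k (K 4) ++ [ X ] → CoalOf Ks G →
    n ≡ proj₁ X + k * 3 → Obtained (copies ((n ∸ proj₁ X) / 3) (K 4) ++ [ X ]) G
  obtained {n} {k} {X} {Ks} perm co eq =
    Ks , subst (λ q → Ks ↭ copies q (K 4) ++ [ X ]) (sym (quotient (proj₁ X) k eq)) perm , co

K₁-unique : ∀ {n} (G : Graph n) → n ≡ 1 → Iso G (proj₂ (K 1))
K₁-unique G refl = record
  { to = λ i → i ; from = λ i → i ; from-to = λ _ → refl ; to-from = λ _ → refl
  ; adj-pres = λ { zero zero → sym (adj-irr G zero) } }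

theorem7 : (n : ℕ) (G : Graph n) → 1 ≤ n → Extremal 4 G →
    ((n % 3 ≡ 0 →
    Obtained (copies ((n ∸ 3) / 3) (K 4) ++ [ K 3 ]) G
    ⊎ ((6 ≤ n) × Obtained (copies ((n ∸ 6) / 3) (K 4) ++ [ θ12 4 ]) G))
    × (n % 3 ≡ 1 →
    (n ≢ 1 → Obtained (copies ((n ∸ 1) / 3) (K 4)) G)
    × (n ≡ 1 → Iso G (proj₂ (K 1))))
    × (n % 3 ≡ 2 →
    Obtained (copies ((n ∸ 2) / 3) (K 4) ++ [ K 2 ]) G
    ⊎ ((5 ≤ n) ×
    (Obtained (copies ((n ∸ 5) / 3) (K 4) ++ [ θ12 3 ]) G
    ⊎ Obtained (copies ((n ∸ 5) / 3) (K 4) ++ [ θ̃₁ ]) G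
    ⊎ Obtained (copies ((n ∸ 5) / 3) (K 4) ++ [ θ̃₂ ]) G))))
theorem7 n G 1≤n ext@((conn , few) , _) with outcome (suc n) G ≤-refl 1≤n conn few
-- Here `f ≥ 2`, while the windmill of the same order has `f ≤ 1` and therefore more edges.
... | sparse p = ⊥-elim (<⇒≱ (+-monoʳ-< (edgeCount G) (≤ᵇ⇒≤ 4 4 tt))
        (≤-trans p (≤-trans (backDegrees-≥ 1≤n) (+-monoˡ-≤ 3 (extremal-≥ 1≤n ext)))))
-- Here `f = 1` although `n ≡ 1 (mod 3)`, where the windmill reaches `f = 0`; this excludes a block
-- K₄ - e.
... | almost k nk p = ⊥-elim (<⇒≱ (+-monoʳ-< (edgeCount G) (≤ᵇ⇒≤ 3 3 tt))
        (≤-trans (≤-reflexive (trans p (backDegrees-tight k nk))) (+-monoˡ-≤ 2 (extremal-≥ 1≤n ext))))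
... | tight k nk p co = impossible 1 k nk ,
        (λ _ → (λ n≢1 → copies k (K 4) , subst (λ q → copies k (K 4) ↭ copies q (K 4)) (sym (quotient 1 k nk)) ↭-refl , co n≢1)
             , K₁-unique G) ,
        impossible 1 k nk
... | special k K₂ nk p perm co = impossible 2 k nk , impossible 2 k nk , λ _ → inj₁ (obtained perm co nk)
... | special k K₃ nk p perm co = (λ _ → inj₁ (obtained perm co nk)) , impossible 3 k nk , impossible 3 k nk
... | special k θ₅ nk p perm co = impossible 5 k nk , impossible 5 k nk ,
        λ _ → inj₂ (at-least 5 k nk , inj₁ (obtained perm co nk))
... | special k θ̃₅ nk p perm co = impossible 5 k nk , impossible 5 k nk ,
        λ _ → inj₂ (at-least 5 k nk , inj₂ (inj₁ (obtained perm co nk)))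
... | special k θ̃₅′ nk p perm co = impossible 5 k nk , impossible 5 k nk ,
        λ _ → inj₂ (at-least 5 k nk , inj₂ (inj₂ (obtained perm co nk)))
... | special k θ₆ nk p perm co = (λ _ → inj₂ (at-least 6 k nk , obtained perm co nk)) , impossible 6 k nk , impossible 6 k nk
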